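{- Let $n\ge 1$ and let $\alpha_1\ge\dots\ge\alpha_n\ge 0$ be ordinals, and $X=\omega^{\alpha_1}\times\dots\times\omega^{\alpha_n}$. If $\alpha_2=\dots=\alpha_n=0$ (in particular if $n=1$), then $\mathbf{w}(X)=1$; otherwise $\mathbf{w}(X)=\omega^{\alpha_1\oplus((\alpha_2\oplus\dots\oplus\alpha_n)-1)}$.
   Context: $X$ has the componentwise order. The width $\mathbf{w}(A)$ of a wqo $A$ is the rank of the forest of nonempty finite sequences of pairwise incomparable elements of $A$ ordered by initial segment. $\oplus$ is the natural (Hessenberg) sum. For ordinals $\beta\le\gamma$, $\gamma-\beta$ denotes the unique $\delta$ with $\beta+\delta=\gamma$. -}

module Defs where

open import Axiom.ExcludedMiddle using (ExcludedMiddle)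
open import Data.Empty using (⊥-elim)
open import Data.Empty.Polymorphic using (⊥)
open import Data.Fin.Base using (Fin; zero; suc)
open import Data.List.Base using (List; []; _∷_; _++_)
open import Data.List.Membership.Propositional using (_∈_)
open import Data.List.Membership.Propositional.Properties using (∈-++⁺ˡ; ∈-++⁺ʳ)
import Data.List.Relation.Unary.All as All
open import Data.List.Relation.Unary.AllPairs using (AllPairs; _∷_)
open import Data.List.Relation.Unary.Any using (here; there)
open import Data.Maybe.Base using (Maybe; just; nothing; maybe′)
open import Data.Nat.Base as ℕ using (ℕ; zero; suc)
import Data.Nat.Properties as ℕₚ
open import Data.Product.Base using (Σ; Σ-syntax; ∃; ∃₂; ∃-syntax; _×_; _,_; proj₁; proj₂; map₂)
open import Data.Sum.Base using (_⊎_; inj₁; inj₂; [_,_]′)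
open import Data.Unit.Polymorphic using (⊤; tt)
open import Function.Base using (id; _∘_; flip)
open import Induction.WellFounded using (Acc; acc; WellFounded)
open import Level using (Level; Lift; lower; _⊔_) renaming (suc to lsuc)
open import Relation.Binary.Bundles using (Preorder)
open import Relation.Binary.Core using (Rel)
import Relation.Binary.Construct.On as On
open import Relation.Binary.PropositionalEquality.Core using (_≡_; _≢_; refl; sym; subst)
open import Relation.Nullary using (¬_; Dec; yes; no)
open import Relation.Nullary.Negation using (contradiction)

private
  variable
    a b c d e r ℓ : Level
    n : ℕ


------------------------------------------------------------------------
-- Ordinals

-- lsup I f is the least ordinal strictly above every f i.  Every small
-- ordinal arises as lsup of the family of its predecessors, but distinct
-- trees can denote the same ordinal: equality of ordinals is _≈_ below.

data Ord ℓ : Set (lsuc ℓ) where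
  lsup : (I : Set ℓ) → (I → Ord ℓ) → Ord ℓ

infix 4 _≤_ _<_ _≈_

-- The comparisons relate ordinals of different universes, because the width
-- of an order on a large type is a tree in a larger universe.

_≤_ _<_ : Ord a → Ord b → Set (a ⊔ b)
lsup I f ≤ β = ∀ i → f i < β

α < lsup J g = ∃[ j ] α ≤ g j

_≈_ : Ord a → Ord b → Set (a ⊔ b)
α ≈ β = α ≤ β × β ≤ α

Branch : Ord ℓ → Set ℓ
Branch (lsup I f) = I

branch : (α : Ord ℓ) → Branch α → Ord ℓ
branch (lsup I f) = f

𝟎 : Ord ℓ
𝟎 = lsup ⊥ λ ()

osuc : Ord ℓ → Ord ℓ
osuc α = lsup ⊤ λ _ → α

𝟏 : Ord ℓ
𝟏 = osuc 𝟎

fromℕ : ℕ → Ord ℓ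
fromℕ zero    = 𝟎
fromℕ (suc n) = osuc (fromℕ n)

ω : Ord ℓ
ω {ℓ} = lsup (Lift ℓ ℕ) (fromℕ ∘ lower)

-- The (non-strict) supremum of a family.

⋃ : (I : Set ℓ) → (I → Ord ℓ) → Ord ℓ
⋃ I f = lsup (Σ I (Branch ∘ f)) λ (i , b) → branch (f i) b

infixl 6 _+_ _⊕_ _-_
infixl 7 _·_
infix  8 ω^_

-- α + β = max(α, sup { (α + β′) + 1 ∣ β′ < β })

_+_ : Ord ℓ → Ord ℓ → Ord ℓ
lsup I f + lsup J g = lsup (I ⊎ J) [ f , (λ j → lsup I f + g j) ]′

-- α · β = sup { α · β′ + α ∣ β′ < β }

_·_ : Ord ℓ → Ord ℓ → Ord ℓ
α · lsup J g = ⋃ J λ j → α · g j + α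

-- ω^ α = max(1, sup { ω^ α′ · ω ∣ α′ < α })

ω^_ : Ord ℓ → Ord ℓ
ω^ lsup I f = ⋃ (Maybe I) (maybe′ (λ i → ω^ (f i) · ω) 𝟏)

-- Natural (Hessenberg) sum:
-- α ⊕ β = sup ({ (α′ ⊕ β) + 1 ∣ α′ < α } ∪ { (α ⊕ β′) + 1 ∣ β′ < β })

_⊕_ : Ord ℓ → Ord ℓ → Ord ℓ
lsup I f ⊕ lsup J g =
  lsup (I ⊎ J) [ (λ i → f i ⊕ lsup J g) , (λ j → lsup I f ⊕ g j) ]′

-- γ - β = sup { (γ′ - β) + 1 ∣ β ≤ γ′ < γ }.  When β ≤ γ this is the unique δ
-- with β + δ ≈ γ, by +-difference and difference-unique below.

_-_ : Ord ℓ → Ord ℓ → Ord ℓ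
lsup K h - β = lsup (∃[ k ] β ≤ h k) λ (k , _) → h k - β

≤-refl : (α : Ord a) → α ≤ α
≤-refl (lsup I f) i = i , ≤-refl (f i)

≤-trans : (α : Ord a) (β : Ord b) (γ : Ord c) → α ≤ β → β ≤ γ → α ≤ γ
≤-trans (lsup _ f) (lsup _ g) (lsup _ h) p q i =
  let j , fi≤gj = p i
      k , gj≤hk = q j
  in k , ≤-trans (f i) (g j) (h k) fi≤gj gj≤hk

≤-<-trans : (α : Ord a) (β : Ord b) (γ : Ord c) → α ≤ β → β < γ → α < γ
≤-<-trans α β (lsup _ h) p (k , q) = k , ≤-trans α β (h k) p q

<-≤-trans : (α : Ord a) (β : Ord b) (γ : Ord c) → α < β → β ≤ γ → α < γ
<-≤-trans α (lsup _ g) (lsup _ h) (j , p) q =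
  let k , gj≤hk = q j in k , ≤-trans α (g j) (h k) p gj≤hk

<-irrefl : (α : Ord a) → ¬ α < α
<-irrefl (lsup I f) (i , p) =
  <-irrefl (f i) (<-≤-trans (f i) (lsup I f) (f i) (i , ≤-refl (f i)) p)

≤-or-> : (∀ {ℓ} → ExcludedMiddle ℓ) → (α : Ord a) (β : Ord b) → α ≤ β ⊎ β < α
≤-or-> lem (lsup I f) β@(lsup J g) with lem {P = ∃[ i ] β ≤ f i}
... | yes β<α = inj₂ β<α
... | no  β≮α = inj₁ λ i → [ id , (λ β≤fi → ⊥-elim (β≮α (i , β≤fi))) ]′ (below i)
  where
  below : ∀ i → f i < β ⊎ β ≤ f i
  below i with lem {P = f i < β}
  ... | yes fi<β = inj₁ fi<β
  ... | no  fi≮β = inj₂ λ j →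
    [ (λ fi≤gj → ⊥-elim (fi≮β (j , fi≤gj))) , id ]′ (≤-or-> lem (f i) (g j))

<-acc : (β α : Ord ℓ) → α ≤ β → Acc _<_ α
<-acc β@(lsup J g) α p = acc λ {γ} γ<α →
  let j , γ≤gj = <-≤-trans γ α β γ<α p in <-acc (g j) γ γ≤gj

<-wellFounded : WellFounded (_<_ {ℓ} {ℓ})
<-wellFounded α = <-acc α α (≤-refl α)

+-difference : (∀ {ℓ} → ExcludedMiddle ℓ) →
               (β γ : Ord ℓ) → β ≤ γ → β + (γ - β) ≈ γ
+-difference lem β@(lsup I f) γ@(lsup K h) β≤γ = below , above
  where
  below : β + (γ - β) ≤ γ
  below (inj₁ i)          = β≤γ i
  below (inj₂ (k , β≤hk)) = k , proj₁ (+-difference lem β (h k) β≤hk)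

  above : γ ≤ β + (γ - β)
  above k with ≤-or-> lem β (h k)
  ... | inj₁ β≤hk        = inj₂ (k , β≤hk) , proj₂ (+-difference lem β (h k) β≤hk)
  ... | inj₂ (i , hk≤fi) = inj₁ i , hk≤fi

α≤α+β : (α β : Ord ℓ) → α ≤ α + β
α≤α+β (lsup I f) (lsup J g) i = inj₁ i , ≤-refl (f i)

+-cancelˡ-≤ : (α β γ : Ord ℓ) → α + β ≤ α + γ → β ≤ γ
+-cancelˡ-≤ α@(lsup I f) (lsup J g) (lsup K h) p j with p (inj₂ j)
... | inj₁ i , q = contradiction
  (i , ≤-trans α (α + g j) (f i) (α≤α+β α (g j)) q) (<-irrefl α)
... | inj₂ k , q = k , +-cancelˡ-≤ α (g j) (h k) q

difference-unique : (∀ {ℓ} → ExcludedMiddle ℓ) →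
                    (β γ δ : Ord ℓ) → β + δ ≈ γ → δ ≈ γ - β
difference-unique lem β γ δ (p , q) =
  +-cancelˡ-≤ β δ (γ - β) (≤-trans (β + δ) γ (β + (γ - β)) p (proj₂ spec)) ,
  +-cancelˡ-≤ β (γ - β) δ (≤-trans (β + (γ - β)) γ (β + δ) (proj₁ spec) q)
  where
  spec : β + (γ - β) ≈ γ
  spec = +-difference lem β γ (≤-trans β (β + δ) γ (α≤α+β β δ) p)

------------------------------------------------------------------------
-- Well-quasi-orders

IsWQO : Preorder c e r → Set (c ⊔ r)
IsWQO P = (s : ℕ → Carrier) → ∃₂ λ i j → i ℕ.< j × s i ≲ s j
  where open Preorder P

record WQO c e r : Set (lsuc (c ⊔ e ⊔ r)) where
  field
    preorder : Preorder c e r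
    isWQO    : IsWQO preorder

  open Preorder preorder public

-- The rank of x is sup { rank y + 1 ∣ R y x }, and the rank of the whole
-- relation is sup { rank x + 1 ∣ x }.

module _ {A : Set a} {R : Rel A r} where

  rankOf : ∀ {x} → Acc R x → Ord (a ⊔ r)
  rankOf {x} (acc rs) = lsup (∃[ y ] R y x) λ (_ , Ryx) → rankOf (rs Ryx)

  rank : WellFounded R → Ord (a ⊔ r)
  rank wf = lsup (Lift r A) λ x → rankOf (wf (lower x))

module _ (P : Preorder c e r) where
  open Preorder P

  Incomparable : Rel Carrier r
  Incomparable x y = ¬ x ≲ y × ¬ y ≲ x

  AntichainSequence : Set (c ⊔ r)
  AntichainSequence = Σ[ xs ∈ List Carrier ] xs ≢ [] × AllPairs Incomparable xs

  -- t ⊐ s: s is a proper initial segment of t.  Ranks are computed along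
  -- extension, so t lies below s in the well-founded relation _⊐_.

  _⊐_ : Rel AntichainSequence c
  (ys , _) ⊐ (xs , _) = ∃₂ λ z zs → ys ≡ xs ++ z ∷ zs

private
  AllPairs-∈ : {A : Set a} {R : Rel A r} (xs : List A) {x y : A} {ys : List A} →
               AllPairs R (xs ++ y ∷ ys) → x ∈ xs → R x y
  AllPairs-∈ (_ ∷ xs) (Rx ∷ _)  (here refl) = All.lookup Rx (∈-++⁺ʳ xs (here refl))
  AllPairs-∈ (_ ∷ xs) (_ ∷ Rxs) (there x∈)  = AllPairs-∈ xs Rxs x∈

⊐-wellFounded : (∀ {ℓ} → ExcludedMiddle ℓ) →
                (P : Preorder c e r) → IsWQO P → WellFounded (_⊐_ P)
⊐-wellFounded {c = c} {r = r} lem P wqo s₀ with lem {P = Acc (_⊐_ P) s₀}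
... | yes acc-s₀ = acc-s₀
... | no ¬acc-s₀ =
  let i , j , i<j , zi≲zj = wqo z
  in contradiction zi≲zj
       (proj₁ (AllPairs-∈ (seq j) (subst (AllPairs (Incomparable P)) (step j)
                                   (proj₂ (proj₂ (proj₁ (bad (suc j))))))
                          (z∈ (ℕₚ.≤⇒≤′ i<j))))
  where
  open Preorder P using (Carrier)

  Bad : Set (c ⊔ r)
  Bad = ∃[ s ] ¬ Acc (_⊐_ P) s

  next : (s : Bad) → Σ[ t ∈ Bad ] _⊐_ P (proj₁ t) (proj₁ s)
  next (s , ¬acc-s) with lem {P = Σ[ t ∈ Bad ] _⊐_ P (proj₁ t) s}
  ... | yes t = t
  ... | no ¬t = contradiction (acc λ {t} t⊐s → accessible t t⊐s) ¬acc-s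
    where
    accessible : ∀ t → _⊐_ P t s → Acc (_⊐_ P) t
    accessible t t⊐s with lem {P = Acc (_⊐_ P) t}
    ... | yes acc-t = acc-t
    ... | no ¬acc-t = contradiction ((t , ¬acc-t) , t⊐s) ¬t

  bad : ℕ → Bad
  bad zero    = s₀ , ¬acc-s₀
  bad (suc n) = proj₁ (next (bad n))

  seq : ℕ → List Carrier
  seq n = proj₁ (proj₁ (bad n))

  z : ℕ → Carrier
  z n = proj₁ (proj₂ (next (bad n)))

  step : ∀ n → seq (suc n) ≡ seq n ++ z n ∷ proj₁ (proj₂ (proj₂ (next (bad n))))
  step n = proj₂ (proj₂ (proj₂ (next (bad n))))

  z∈ : ∀ {i j} → suc i ℕ.≤′ j → z i ∈ seq j
  z∈ {i} (ℕ.≤′-reflexive refl) =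
    subst (z i ∈_) (sym (step i)) (∈-++⁺ʳ (seq i) (here refl))
  z∈ {i} (ℕ.≤′-step {j} i<j) =
    subst (z i ∈_) (sym (step j)) (∈-++⁺ˡ (z∈ i<j))

width : (∀ {ℓ} → ExcludedMiddle ℓ) → WQO c e r → Ord (c ⊔ r)
width lem A = rank (⊐-wellFounded lem (WQO.preorder A) (WQO.isWQO A))

------------------------------------------------------------------------
-- Products of ordinals

≤-preorder : ∀ ℓ → Preorder (lsuc ℓ) ℓ ℓ
≤-preorder ℓ = record
  { Carrier    = Ord ℓ
  ; _≈_        = _≈_
  ; _≲_        = _≤_
  ; isPreorder = record
    { isEquivalence = record
      { refl  = λ {α} → ≤-refl α , ≤-refl α
      ; sym   = λ (p , q) → q , p
      ; trans = λ {α} {β} {γ} (p , q) (p′ , q′) →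
          ≤-trans α β γ p p′ , ≤-trans γ β α q′ q
      }
    ; reflexive = proj₁
    ; trans     = λ {α} {β} {γ} → ≤-trans α β γ
    }
  }

-- An ordinal as the ordered set of the ordinals strictly below it.

below : Ord ℓ → Preorder (lsuc ℓ) ℓ ℓ
below {ℓ} α = On.preorder (≤-preorder ℓ) (proj₁ {B = _< α})

∏ : (Fin n → Preorder c e r) → Preorder c e r
∏ P = record
  { Carrier    = ∀ i → Carrier (P i)
  ; _≈_        = λ x y → ∀ i → P._≈_ i (x i) (y i)
  ; _≲_        = λ x y → ∀ i → P._≲_ i (x i) (y i)
  ; isPreorder = record
    { isEquivalence = record
      { refl  = λ i → Eq.refl (P i)
      ; sym   = λ p i → Eq.sym (P i) (p i)
      ; trans = λ p q i → Eq.trans (P i) (p i) (q i)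
      }
    ; reflexive = λ p i → reflexive (P i) (p i)
    ; trans     = λ p q i → trans (P i) (p i) (q i)
    }
  }
  where
  open Preorder
  module P i = Preorder (P i)

-- Every sequence has a nondecreasing subsequence.

Subsequential : Preorder c e r → Set (c ⊔ r)
Subsequential P = (s : ℕ → Carrier) → Σ[ φ ∈ (ℕ → ℕ) ]
  (∀ {i j} → i ℕ.< j → φ i ℕ.< φ j) × (∀ {i j} → i ℕ.≤ j → s (φ i) ≲ s (φ j))
  where open Preorder P

∏-subsequential : (P : Fin n → Preorder c e r) →
                  (∀ i → Subsequential (P i)) → Subsequential (∏ P)
∏-subsequential {zero}  P sub s = id , id , λ _ ()
∏-subsequential {suc n} P sub s =
  let φ , φ-mono , s₀-mono = sub zero (λ k → s k zero)
      ψ , ψ-mono , s₊-mono = ∏-subsequential (P ∘ suc) (sub ∘ suc) (λ k i → s (φ k) (suc i))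
  in φ ∘ ψ , φ-mono ∘ ψ-mono , λ i≤j → λ where
       zero    → s₀-mono (weaken ψ ψ-mono i≤j)
       (suc i) → s₊-mono i≤j i
  where
  weaken : (ψ : ℕ → ℕ) → (∀ {i j} → i ℕ.< j → ψ i ℕ.< ψ j) →
           ∀ {i j} → i ℕ.≤ j → ψ i ℕ.≤ ψ j
  weaken ψ mono i≤j with ℕₚ.m≤n⇒m<n∨m≡n i≤j
  ... | inj₁ i<j  = ℕₚ.<⇒≤ (mono i<j)
  ... | inj₂ refl = ℕₚ.≤-refl

subsequential⇒WQO : (P : Preorder c e r) → Subsequential P → IsWQO P
subsequential⇒WQO P sub s =
  let φ , φ-mono , s-mono = sub s
  in φ 0 , φ 1 , φ-mono ℕ.z<s , s-mono ℕ.z≤n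

below-subsequential : (∀ {ℓ} → ExcludedMiddle ℓ) → (α : Ord ℓ) → Subsequential (below α)
below-subsequential lem α s′ = φ , φ-mono ∘ ℕₚ.≤⇒≤′ , s-mono ∘ ℕₚ.≤⇒≤′
  where
  s : ℕ → Ord _
  s = proj₁ ∘ s′

  Minimal : ℕ → ℕ → Set _
  Minimal N k = N ℕ.≤ k × (∀ j → N ℕ.≤ j → s k ≤ s j)

  minimal′ : ∀ N k → N ℕ.≤ k → Acc _<_ (s k) → ∃ (Minimal N)
  minimal′ N k N≤k (acc rs) with lem {P = ∃[ j ] N ℕ.≤ j × s j < s k}
  ... | yes (j , N≤j , sj<sk) = minimal′ N j N≤j (rs sj<sk)
  ... | no  none = k , N≤k , λ j N≤j →
    [ id , (λ sj<sk → ⊥-elim (none (j , N≤j , sj<sk))) ]′ (≤-or-> lem (s k) (s j))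

  minimal : ∀ N → ∃ (Minimal N)
  minimal N = minimal′ N N ℕₚ.≤-refl (<-wellFounded (s N))

  start φ : ℕ → ℕ
  start zero    = 0
  start (suc n) = suc (φ n)
  φ n = proj₁ (minimal (start n))

  start≤φ : ∀ n → start n ℕ.≤ φ n
  start≤φ n = proj₁ (proj₂ (minimal (start n)))

  φ-mono : ∀ {i j} → suc i ℕ.≤′ j → φ i ℕ.< φ j
  φ-mono {i} (ℕ.≤′-reflexive refl) = start≤φ (suc i)
  φ-mono {i} (ℕ.≤′-step {j} i<j)   = ℕₚ.<-trans (φ-mono i<j) (start≤φ (suc j))

  s-mono : ∀ {i j} → i ℕ.≤′ j → s (φ i) ≤ s (φ j)
  s-mono {i} (ℕ.≤′-reflexive refl) = ≤-refl (s (φ i))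
  s-mono {i} (ℕ.≤′-step {j} i≤j)   =
    ≤-trans (s (φ i)) (s (φ j)) (s (φ (suc j))) (s-mono i≤j)
      (proj₂ (proj₂ (minimal (start j))) (φ (suc j))
        (ℕₚ.≤-trans (start≤φ j) (ℕₚ.<⇒≤ (start≤φ (suc j)))))

-- The Cartesian product of finitely many ordinals, ordered componentwise.

productWQO : (∀ {ℓ} → ExcludedMiddle ℓ) → (Fin n → Ord ℓ) → WQO (lsuc ℓ) ℓ ℓ
productWQO lem α = record
  { preorder = ∏ (below ∘ α)
  ; isWQO    = subsequential⇒WQO (∏ (below ∘ α))
                 (∏-subsequential (below ∘ α) (below-subsequential lem ∘ α))
  }

{-# OPTIONS --safe #-}

-- The width of a subset S is the supremum of w(S ⊥ x) + 1 over x ∈ S, where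
-- S ⊥ x is the set of elements of S incomparable to x.  Consider boxes whose
-- i-th side has length ω^αᵢ, and put ε = α₁ ⊕ ((α₂ ⊕ … ⊕ αₙ) - 1).
--
-- Upper bound: y ⊥ x forces yᵢ < xᵢ for some i, and the part of side i below xᵢ
-- is covered by finitely many intervals of length ω^α′ with α′ < αᵢ.  Hence
-- S ⊥ x is a finite union of boxes with smaller exponent ε′ < ε, and ω^ε is
-- closed under natural sums.
--
-- Lower bound: if α′ < αᵢ and αⱼ > 0 with j ≠ i, a box contains k boxes with αᵢ
-- replaced by α′, stacked in direction i.  An antichain of the top box is finite,
-- so a final segment of side j remains beyond it, and the antichain can be
-- continued in the box underneath.  The widths of the k boxes therefore add up.
-- What remains is to reach every exponent below ε while keeping two positive
-- exponents: this gives every exponent strictly below ⊕ᵢ αᵢ, and ⊕ᵢ αᵢ itself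
-- when both α₁ and α₂ ⊕ … ⊕ αₙ are infinite.

module Submission where

open import Axiom.ExcludedMiddle using (ExcludedMiddle)
open import Data.Fin.Base as Fin using (Fin; zero; suc)
open import Data.Fin.Properties using (_≟_; ¬∀⟶∃¬)
open import Data.List.Base using (List; []; _∷_; _++_)
open import Data.List.Properties using (++-conicalʳ)
open import Data.List.Relation.Unary.All as All using (All; []; _∷_)
open import Data.List.Relation.Unary.All.Properties using (++⁻ˡ; ++⁻ʳ; ∷ʳ⁺)
open import Data.List.Relation.Unary.AllPairs using (AllPairs; []; _∷_)
import Data.List.Relation.Unary.AllPairs.Properties as AllPairs
open import Data.Maybe.Base using (just; nothing; maybe′)
open import Data.Nat.Base as ℕ using (ℕ; zero; suc)
import Data.Nat.Properties as ℕₚ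
open import Data.Product.Base using (∃; ∃₂; ∃-syntax; Σ-syntax; _×_; _,_; proj₁; proj₂)
open import Data.Sum.Base using (_⊎_; inj₁; inj₂; [_,_]′)
open import Data.Unit.Polymorphic using (tt)
open import Data.Vec.Functional using (Vector; head; tail; foldr; updateAt)
open import Data.Vec.Functional.Properties using (updateAt-updates; updateAt-minimal)
open import Function.Base using (_∘_)
open import Induction.WellFounded using (Acc; acc; WellFounded)
open import Level using (Level; lift; lower; _⊔_)
open import Relation.Binary.Bundles using (Preorder)
open import Relation.Binary.Core using (Rel)
open import Relation.Binary.PropositionalEquality.Core using (_≡_; _≢_; refl; sym; subst)
open import Relation.Nullary using (¬_; yes; no)
open import Relation.Nullary.Negation using (contradiction)
open import Relation.Unary using (Pred; _⊆_)
open import Defs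

private
  variable
    a b c e p q r ℓ : Level
    n : ℕ

-- Order

infixl 4 _⟨≤≤⟩_ _⟨≤<⟩_ _⟨<≤⟩_

_⟨≤≤⟩_ : {α : Ord a} {β : Ord b} {γ : Ord c} → α ≤ β → β ≤ γ → α ≤ γ
_⟨≤≤⟩_ = ≤-trans _ _ _

_⟨≤<⟩_ : {α : Ord a} {β : Ord b} {γ : Ord c} → α ≤ β → β < γ → α < γ
_⟨≤<⟩_ = ≤-<-trans _ _ _

_⟨<≤⟩_ : {α : Ord a} {β : Ord b} {γ : Ord c} → α < β → β ≤ γ → α < γ
_⟨<≤⟩_ = <-≤-trans _ _ _

branch-< : (α : Ord ℓ) (i : Branch α) → branch α i < α
branch-< (lsup I f) i = i , ≤-refl (f i)

≤-branch : {α : Ord a} (β : Ord b) {j : Branch β} → α ≤ branch β j → α < β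
≤-branch (lsup J g) {j} p = j , p

<⇒≤ : (α : Ord a) (β : Ord b) → α < β → α ≤ β
<⇒≤ (lsup I f) (lsup J g) (j , p) i = j , <⇒≤ (f i) (g j) (p i)

α<osuc : (α : Ord ℓ) → α < osuc α
α<osuc α = tt , ≤-refl α

<⇒osuc≤ : {α : Ord a} {β : Ord b} → α < β → osuc α ≤ β
<⇒osuc≤ p _ = p

osuc≤⇒< : {α : Ord a} {β : Ord b} → osuc α ≤ β → α < β
osuc≤⇒< p = p tt

<-trans : {α : Ord a} {β : Ord b} {γ : Ord c} → α < β → β < γ → α < γ
<-trans {β = β} {γ} p q = p ⟨<≤⟩ <⇒≤ β γ q

osuc-mono : {α : Ord a} {β : Ord b} → α ≤ β → osuc α ≤ osuc β
osuc-mono p _ = tt , p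

𝟎≤ : (α : Ord b) → 𝟎 {a} ≤ α
𝟎≤ α ()

≮𝟎 : {α : Ord a} {B : Set c} → α < 𝟎 {b} → B
≮𝟎 ()

≤-intro : (α : Ord a) (β : Ord b) → (∀ i → branch α i < β) → α ≤ β
≤-intro (lsup I f) β p = p

⋃-upper : {I : Set ℓ} (f : I → Ord ℓ) (i : I) → f i ≤ ⋃ I f
⋃-upper f i = ≤-intro (f i) (⋃ _ f) λ b → (i , b) , ≤-refl (branch (f i) b)

⋃-least : {I : Set ℓ} (f : I → Ord ℓ) {β : Ord b} → (∀ i → f i ≤ β) → ⋃ I f ≤ β
⋃-least f p (i , b) = branch-< (f i) b ⟨<≤⟩ p i

<-⋃ : {I : Set ℓ} (f : I → Ord ℓ) {α : Ord a} → α < ⋃ I f → ∃[ i ] α < f i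
<-⋃ f ((i , b) , p) = i , ≤-branch (f i) p

-- Addition

β≤α+β : (α β : Ord ℓ) → β ≤ α + β
β≤α+β (lsup I f) (lsup J g) j = inj₂ j , β≤α+β (lsup I f) (g j)

+-monoʳ-≤ : (α : Ord ℓ) {β γ : Ord ℓ} → β ≤ γ → α + β ≤ α + γ
+-monoʳ-≤ (lsup I f) {lsup J g} {lsup K h} p (inj₁ i) = inj₁ i , ≤-refl (f i)
+-monoʳ-≤ (lsup I f) {lsup J g} {lsup K h} p (inj₂ j) =
  let k , q = p j in inj₂ k , +-monoʳ-≤ (lsup I f) q

+-monoʳ-< : (α : Ord ℓ) {β γ : Ord ℓ} → β < γ → α + β < α + γ
+-monoʳ-< (lsup I f) {β} {lsup K h} (k , q) = inj₂ k , +-monoʳ-≤ (lsup I f) q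

+-monoˡ-≤ : {α β : Ord ℓ} (γ : Ord ℓ) → α ≤ β → α + γ ≤ β + γ
+-monoˡ-≤ {α = lsup I f} {lsup J g} (lsup K h) p (inj₁ i) =
  p i ⟨<≤⟩ α≤α+β (lsup J g) (lsup K h)
+-monoˡ-≤ {α = lsup I f} {lsup J g} (lsup K h) p (inj₂ k) = inj₂ k , +-monoˡ-≤ (h k) p

+-mono-≤ : {α α′ β β′ : Ord ℓ} → α ≤ α′ → β ≤ β′ → α + β ≤ α′ + β′
+-mono-≤ {α′ = α′} {β = β} p q = +-monoˡ-≤ β p ⟨≤≤⟩ +-monoʳ-≤ α′ q

+-assoc-≤ : (α β γ : Ord ℓ) → (α + β) + γ ≤ α + (β + γ)
+-assoc-≤ (lsup I f) (lsup J g) (lsup K h) (inj₁ (inj₁ i)) = inj₁ i , ≤-refl (f i)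
+-assoc-≤ (lsup I f) (lsup J g) (lsup K h) (inj₁ (inj₂ j)) =
  inj₂ (inj₁ j) , ≤-refl (lsup I f + g j)
+-assoc-≤ (lsup I f) (lsup J g) (lsup K h) (inj₂ k) =
  inj₂ (inj₂ k) , +-assoc-≤ (lsup I f) (lsup J g) (h k)

+-assoc-≥ : (α β γ : Ord ℓ) → α + (β + γ) ≤ (α + β) + γ
+-assoc-≥ (lsup I f) (lsup J g) (lsup K h) (inj₁ i) = inj₁ (inj₁ i) , ≤-refl (f i)
+-assoc-≥ (lsup I f) (lsup J g) (lsup K h) (inj₂ (inj₁ j)) =
  inj₁ (inj₂ j) , ≤-refl (lsup I f + g j)
+-assoc-≥ (lsup I f) (lsup J g) (lsup K h) (inj₂ (inj₂ k)) =
  inj₂ k , +-assoc-≥ (lsup I f) (lsup J g) (h k)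

+-identityʳ-≤ : (α : Ord ℓ) → α + 𝟎 ≤ α
+-identityʳ-≤ (lsup I f) (inj₁ i) = i , ≤-refl (f i)

<-+ : {γ : Ord a} (α β : Ord ℓ) → γ < α + β → γ < α ⊎ ∃[ j ] γ ≤ α + branch β j
<-+ (lsup I f) (lsup J g) (inj₁ i , p) = inj₁ (i , p)
<-+ (lsup I f) (lsup J g) (inj₂ j , p) = inj₂ (j , p)

-- Natural sum

⊕-mono-≤ : {α α′ β β′ : Ord ℓ} → α ≤ α′ → β ≤ β′ → α ⊕ β ≤ α′ ⊕ β′
⊕-mono-≤ {α = lsup _ _} {lsup _ _} {lsup _ _} {lsup _ _} p q (inj₁ i) =
  let i′ , p′ = p i in inj₁ i′ , ⊕-mono-≤ p′ q
⊕-mono-≤ {α = lsup _ _} {lsup _ _} {lsup _ _} {lsup _ _} p q (inj₂ j) =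
  let j′ , q′ = q j in inj₂ j′ , ⊕-mono-≤ p q′

⊕-monoˡ-< : {α α′ : Ord ℓ} (β : Ord ℓ) → α < α′ → α ⊕ β < α′ ⊕ β
⊕-monoˡ-< {α′ = lsup _ _} β@(lsup _ _) (i , p) = inj₁ i , ⊕-mono-≤ p (≤-refl β)

⊕-monoʳ-< : (α : Ord ℓ) {β β′ : Ord ℓ} → β < β′ → α ⊕ β < α ⊕ β′
⊕-monoʳ-< α@(lsup _ _) {β′ = lsup _ _} (j , p) = inj₂ j , ⊕-mono-≤ (≤-refl α) p

α≤α⊕β : (α β : Ord ℓ) → α ≤ α ⊕ β
α≤α⊕β (lsup I f) (lsup J g) i = inj₁ i , α≤α⊕β (f i) (lsup J g)

β≤α⊕β : (α β : Ord ℓ) → β ≤ α ⊕ β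
β≤α⊕β (lsup I f) (lsup J g) j = inj₂ j , β≤α⊕β (lsup I f) (g j)

⊕-identityʳ-≤ : {α β : Ord ℓ} → β ≤ 𝟎 {ℓ} → α ⊕ β ≤ α
⊕-identityʳ-≤ {α = lsup I f} {lsup J g} p (inj₁ i) = i , ⊕-identityʳ-≤ p
⊕-identityʳ-≤ {α = lsup I f} {lsup J g} p (inj₂ j) = ≮𝟎 {α = g j} (p j)

⊕-identityˡ-≤ : {α β : Ord ℓ} → α ≤ 𝟎 {ℓ} → α ⊕ β ≤ β
⊕-identityˡ-≤ {α = lsup I f} {lsup J g} p (inj₁ i) = ≮𝟎 {α = f i} (p i)
⊕-identityˡ-≤ {α = lsup I f} {lsup J g} p (inj₂ j) = j , ⊕-identityˡ-≤ p

<-⊕ : {γ : Ord a} (α β : Ord ℓ) → γ < α ⊕ β →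
      (∃[ i ] γ ≤ branch α i ⊕ β) ⊎ (∃[ j ] γ ≤ α ⊕ branch β j)
<-⊕ (lsup I f) (lsup J g) (inj₁ i , p) = inj₁ (i , p)
<-⊕ (lsup I f) (lsup J g) (inj₂ j , p) = inj₂ (j , p)

+≤⊕ : (α β : Ord ℓ) → α + β ≤ α ⊕ β
+≤⊕ (lsup I f) (lsup J g) (inj₁ i) = inj₁ i , α≤α⊕β (f i) (lsup J g)
+≤⊕ (lsup I f) (lsup J g) (inj₂ j) = inj₂ j , +≤⊕ (lsup I f) (g j)

fromℕ-⊕ : ∀ k l → fromℕ {ℓ} k ⊕ fromℕ l ≤ fromℕ {ℓ} (k ℕ.+ l)
fromℕ-⊕ zero    l       = ⊕-identityˡ-≤ {α = 𝟎} {fromℕ l} (𝟎≤ 𝟎)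
fromℕ-⊕ (suc k) zero    (inj₁ _) = tt , fromℕ-⊕ k zero
fromℕ-⊕ (suc k) (suc l) (inj₁ _) = tt , fromℕ-⊕ k (suc l)
fromℕ-⊕ (suc k) (suc l) (inj₂ _) =
  tt , (fromℕ-⊕ (suc k) l ⟨≤≤⟩ suc-+ k l)
  where
  suc-+ : ∀ k l → fromℕ {ℓ} (suc k ℕ.+ l) ≤ fromℕ {ℓ} (k ℕ.+ suc l)
  suc-+ zero    l = ≤-refl (fromℕ (suc l))
  suc-+ (suc k) l = osuc-mono (suc-+ k l)

-- Multiplication and powers of ω

·-zero : (α : Ord ℓ) → α · 𝟎 ≤ 𝟎 {ℓ}
·-zero α (() , _)

·-osuc-≤ : (α β : Ord ℓ) → α · osuc β ≤ α · β + α
·-osuc-≤ α β = ⋃-least (λ _ → α · β + α) λ _ → ≤-refl (α · β + α)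

·-osuc-≥ : (α β : Ord ℓ) → α · β + α ≤ α · osuc β
·-osuc-≥ α β = ⋃-upper (λ _ → α · β + α) tt

·-monoˡ-≤ : {α β : Ord ℓ} (γ : Ord ℓ) → α ≤ β → α · γ ≤ β · γ
·-monoˡ-≤ {α = α} {β} (lsup K h) p = ⋃-least (λ k → α · h k + α) λ k →
  +-mono-≤ (·-monoˡ-≤ (h k) p) p ⟨≤≤⟩ ⋃-upper (λ k → β · h k + β) k

𝟏≤ω^ : (α : Ord ℓ) → 𝟏 {a} ≤ ω^ α
𝟏≤ω^ (lsup I f) _ = (nothing , tt) , 𝟎≤ 𝟎

ω^>𝟎 : (α : Ord ℓ) → 𝟎 {a} < ω^ α
ω^>𝟎 α = 𝟏≤ω^ α tt

ω^·ω-≤ : {I : Set ℓ} (f : I → Ord ℓ) (i : I) → ω^ (f i) · ω ≤ ω^ (lsup I f)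
ω^·ω-≤ f i = ⋃-upper (maybe′ (λ i → ω^ (f i) · ω) 𝟏) (just i)

ω^-mono-≤ : {α β : Ord ℓ} → α ≤ β → ω^ α ≤ ω^ β
ω^-mono-≤ {α = lsup I f} {β@(lsup J g)} p = ⋃-least (maybe′ (λ i → ω^ (f i) · ω) 𝟏) λ where
  nothing  → 𝟏≤ω^ β
  (just i) → let j , q = p i in ·-monoˡ-≤ ω (ω^-mono-≤ q) ⟨≤≤⟩ ω^·ω-≤ g j

ω^·-< : {α β : Ord ℓ} → α < β → ∀ k → ω^ α · fromℕ k < ω^ β
ω^·-< {β = lsup J g} (j , p) k =
  ·-monoˡ-≤ (fromℕ k) (ω^-mono-≤ p) ⟨≤<⟩ below-ω ⟨<≤⟩ ω^·ω-≤ g j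
  where
  below-ω : ω^ (g j) · fromℕ k < ω^ (g j) · ω
  below-ω =
    α≤α+β (ω^ (g j) · fromℕ k) 𝟎 ⟨≤<⟩
    +-monoʳ-< (ω^ (g j) · fromℕ k) (ω^>𝟎 (g j)) ⟨<≤⟩
    ⋃-upper (λ l → ω^ (g j) · fromℕ (lower l) + ω^ (g j)) (lift k)

ω^-mono-< : {α β : Ord ℓ} → α < β → ω^ α < ω^ β
ω^-mono-< {α = α} {β} p =
  β≤α+β (ω^ α · 𝟎) (ω^ α) ⟨≤≤⟩ ·-osuc-≥ (ω^ α) 𝟎 ⟨≤<⟩ ω^·-< {β = β} p 1

-- One step of a Cantor normal form: it later cuts the part of a side `ω^ α` below a point into
-- finitely many intervals whose length is a smaller power.
<-ω^ : {γ : Ord a} (α : Ord ℓ) → γ < ω^ α →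
       γ ≤ 𝟎 {ℓ} ⊎ ∃₂ λ i k → γ < ω^ (branch α i) · fromℕ k
<-ω^ (lsup I f) ((nothing , _) , p)         = inj₁ p
<-ω^ {γ = γ} (lsup I f) ((just i , lift k , b) , p) = inj₂ (i , suc k ,
  (≤-branch {α = γ} (ω^ (f i) · fromℕ k + ω^ (f i)) p ⟨<≤⟩ ·-osuc-≥ (ω^ (f i)) (fromℕ k)))

-- Additively closed ordinals

⊕-Closed : Ord ℓ → Set _
⊕-Closed {ℓ} κ = ∀ {α β : Ord ℓ} → α < κ → β < κ → α ⊕ β < κ

-- A descent either lowers the remainder `α` or breaks up one of the `k` copies of `κ`, leaving some
-- `β < κ` of it. The bound is again of the form multiple plus remainder, as the induction in
-- `⊕-·-≤` requires.
<-·+ : {γ : Ord a} (κ : Ord ℓ) → 𝟎 {ℓ} < κ → ∀ k (α : Ord ℓ) → γ < κ · fromℕ k + α →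
       (∃[ i ] γ ≤ κ · fromℕ k + branch α i) ⊎
       (∃₂ λ l β → k ≡ suc l × β < κ × γ ≤ κ · fromℕ l + β)
<-·+ {γ = γ} κ κ>𝟎 k α p with <-+ {γ = γ} (κ · fromℕ k) α p
<-·+ κ κ>𝟎 k       α p | inj₂ q = inj₁ q
<-·+ {γ = γ} κ κ>𝟎 zero    α p | inj₁ q = ≮𝟎 {α = γ} (q ⟨<≤⟩ ·-zero κ)
<-·+ {γ = γ} κ κ>𝟎 (suc k) α p | inj₁ q
  with <-+ {γ = γ} (κ · fromℕ k) κ (q ⟨<≤⟩ ·-osuc-≤ κ (fromℕ k))
... | inj₁ r       = inj₂ (k , 𝟎 , refl , κ>𝟎 ,
                       ≤-trans γ (κ · fromℕ k) (κ · fromℕ k + 𝟎)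
                         (<⇒≤ γ (κ · fromℕ k) r) (α≤α+β (κ · fromℕ k) 𝟎))
... | inj₂ (j , r) = inj₂ (k , branch κ j , refl , branch-< κ j , r)

-- Lowering a remainder lowers `α ⊕ β`. Lowering a coefficient frees a whole copy of `κ`, which by
-- closure exceeds the natural sum of the new remainders.
⊕-·-≤ : (κ : Ord ℓ) → 𝟎 {ℓ} < κ → ⊕-Closed κ → ∀ k l (α β : Ord ℓ) → α < κ → β < κ →
        (κ · fromℕ k + α) ⊕ (κ · fromℕ l + β) ≤ κ · fromℕ (k ℕ.+ l) + (α ⊕ β)
⊕-·-≤ {ℓ} κ κ>𝟎 closed k l α β = step k l α β (<-wellFounded (α ⊕ β))
  where
  step : ∀ k l (α β : Ord ℓ) → Acc _<_ (α ⊕ β) → α < κ → β < κ →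
         (κ · fromℕ k + α) ⊕ (κ · fromℕ l + β) ≤ κ · fromℕ (k ℕ.+ l) + (α ⊕ β)
  step k l α β (acc rs) α<κ β<κ =
    ≤-intro (ka ⊕ lb) _ λ b →
      [ (λ (i , q) → left (<-·+ κ κ>𝟎 k α (branch-< ka i)) q)
      , (λ (j , q) → right (<-·+ κ κ>𝟎 l β (branch-< lb j)) q) ]′
        (<-⊕ ka lb (branch-< (ka ⊕ lb) b))
    where
    ka lb : Ord _
    ka = κ · fromℕ k + α
    lb = κ · fromℕ l + β

    left : {γ δ : Ord _} →
           (∃[ i ] δ ≤ κ · fromℕ k + branch α i) ⊎
           (∃₂ λ k′ α′ → k ≡ suc k′ × α′ < κ × δ ≤ κ · fromℕ k′ + α′) →
           γ ≤ δ ⊕ lb → γ < κ · fromℕ (k ℕ.+ l) + (α ⊕ β)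
    left (inj₁ (i , p)) q =
      q ⟨≤≤⟩ ⊕-mono-≤ p (≤-refl lb)
        ⟨≤≤⟩ step k l (branch α i) β (rs (⊕-monoˡ-< β (branch-< α i)))
               (<-trans (branch-< α i) α<κ) β<κ
        ⟨≤<⟩ +-monoʳ-< (κ · fromℕ (k ℕ.+ l)) (⊕-monoˡ-< β (branch-< α i))
    -- The new remainder may be larger, so accessibility restarts; the recursion is lexicographic,
    -- with the coefficients before the remainders.
    left (inj₂ (k′ , α′ , refl , α′<κ , p)) q =
      q ⟨≤≤⟩ ⊕-mono-≤ p (≤-refl lb)
        ⟨≤≤⟩ step k′ l α′ β (<-wellFounded (α′ ⊕ β)) α′<κ β<κ
        ⟨≤<⟩ +-monoʳ-< (κ · fromℕ (k′ ℕ.+ l)) (closed α′<κ β<κ)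
        ⟨<≤⟩ ·-osuc-≥ κ (fromℕ (k′ ℕ.+ l))
        ⟨<≤⟩ α≤α+β (κ · fromℕ (k ℕ.+ l)) (α ⊕ β)

    right : {γ δ : Ord _} →
            (∃[ j ] δ ≤ κ · fromℕ l + branch β j) ⊎
            (∃₂ λ l′ β′ → l ≡ suc l′ × β′ < κ × δ ≤ κ · fromℕ l′ + β′) →
            γ ≤ ka ⊕ δ → γ < κ · fromℕ (k ℕ.+ l) + (α ⊕ β)
    right (inj₁ (j , p)) q =
      q ⟨≤≤⟩ ⊕-mono-≤ (≤-refl ka) p
        ⟨≤≤⟩ step k l α (branch β j) (rs (⊕-monoʳ-< α (branch-< β j)))
               α<κ (<-trans (branch-< β j) β<κ)
        ⟨≤<⟩ +-monoʳ-< (κ · fromℕ (k ℕ.+ l)) (⊕-monoʳ-< α (branch-< β j))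
    right (inj₂ (l′ , β′ , refl , β′<κ , p)) q rewrite ℕₚ.+-suc k l′ =
      q ⟨≤≤⟩ ⊕-mono-≤ (≤-refl ka) p
        ⟨≤≤⟩ step k l′ α β′ (<-wellFounded (α ⊕ β′)) α<κ β′<κ
        ⟨≤<⟩ +-monoʳ-< (κ · fromℕ (k ℕ.+ l′)) (closed α<κ β′<κ)
        ⟨<≤⟩ ·-osuc-≥ κ (fromℕ (k ℕ.+ l′))
        ⟨<≤⟩ α≤α+β (κ · fromℕ (suc (k ℕ.+ l′))) (α ⊕ β)

-- Difference

-‿monoˡ-≤ : (β : Ord b) {γ γ′ : Ord b} → γ ≤ γ′ → γ - β ≤ γ′ - β
-‿monoˡ-≤ β {lsup K h} {lsup K′ h′} p (k , q) =
  let k′ , p′ = p k in (k′ , (q ⟨≤≤⟩ p′)) , -‿monoˡ-≤ β p′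

-- The hypothesis `β ≤ γ` makes the predecessor of `γ′` that bounds `γ` an admissible index of
-- `γ′ - β`.
-‿monoˡ-< : {β γ γ′ : Ord ℓ} → β ≤ γ → γ < γ′ → γ - β < γ′ - β
-‿monoˡ-< {β = β} {γ′ = lsup K h} q (k , p) = (k , (q ⟨≤≤⟩ p)) , -‿monoˡ-≤ β p

γ-β≤γ : (γ β : Ord ℓ) → γ - β ≤ γ
γ-β≤γ (lsup K h) β (k , _) = k , γ-β≤γ (h k) β

-- Vectors of ordinals

⨁ : Vector (Ord ℓ) n → Ord ℓ
⨁ = foldr _⊕_ 𝟎

_[_]≔_ : {A : Set a} → Vector A n → Fin n → A → Vector A n
v [ i ]≔ x = updateAt v i (λ _ → x)

≔-elim : {A : Set a} (Q : Fin n → A → Set b) {v : Vector A n} {i : Fin n} {x : A} →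
         Q i x → (∀ j → j ≢ i → Q j (v j)) → ∀ j → Q j ((v [ i ]≔ x) j)
≔-elim Q {v} {i} {x} at off j with j ≟ i
... | yes refl = subst (Q j) (sym (updateAt-updates j v)) at
... | no  j≢i  = subst (Q j) (sym (updateAt-minimal j i v j≢i)) (off j j≢i)

≔-at : {A : Set a} (Q : A → Set b) (v : Vector A n) (i : Fin n) {x : A} →
       Q ((v [ i ]≔ x) i) → Q x
≔-at Q v i = subst Q (updateAt-updates i v)

≔-off : {A : Set a} (Q : A → Set b) (v : Vector A n) (i : Fin n) {x : A} {j : Fin n} →
        j ≢ i → Q ((v [ i ]≔ x) j) → Q (v j)
≔-off Q v i {j = j} j≢i = subst Q (updateAt-minimal j i v j≢i)

component≤⨁ : (α : Vector (Ord ℓ) n) (i : Fin n) → α i ≤ ⨁ α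
component≤⨁ α zero    = α≤α⊕β (α zero) (⨁ (tail α))
component≤⨁ α (suc i) = component≤⨁ (tail α) i ⟨≤≤⟩ β≤α⊕β (α zero) (⨁ (tail α))

⨁-≔-< : (α : Vector (Ord ℓ) n) (i : Fin n) {α′ : Ord ℓ} → α′ < α i → ⨁ (α [ i ]≔ α′) < ⨁ α
⨁-≔-< α zero    p = ⊕-monoˡ-< (⨁ (tail α)) p
⨁-≔-< α (suc i) p = ⊕-monoʳ-< (α zero) (⨁-≔-< (tail α) i p)

-- Iterates `<-⊕` through the vector. The lower bound learns from it which exponent to decrease.
<-⨁ : {γ : Ord a} (α : Vector (Ord ℓ) n) → γ < ⨁ α →
      ∃₂ λ i α′ → α′ < α i × γ ≤ ⨁ (α [ i ]≔ α′)
<-⨁ {n = suc n} {γ = γ} α p with <-⊕ {γ = γ} (α zero) (⨁ (tail α)) p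
... | inj₁ (i , q) = zero , branch (α zero) i , branch-< (α zero) i , q
... | inj₂ (j , q) =
  let k , α′ , α′<αₖ , r = <-⨁ (tail α) (branch-< (⨁ (tail α)) j)
  in suc k , α′ , α′<αₖ , (q ⟨≤≤⟩ ⊕-mono-≤ (≤-refl (α zero)) r)

<ω⇒⨁<ω : (α : Vector (Ord ℓ) n) → (∀ i → α i < ω {ℓ}) → ⨁ α < ω {ℓ}
<ω⇒⨁<ω {n = zero}  α p = lift 0 , ≤-refl 𝟎
<ω⇒⨁<ω {n = suc n} α p =
  let lift k , q = p zero
      lift l , r = <ω⇒⨁<ω (tail α) (λ i → p (suc i))
  in lift (k ℕ.+ l) , (⊕-mono-≤ q r ⟨≤≤⟩ fromℕ-⊕ k l)

-- Closure properties of powers of ω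

module Classical (lem : ∀ {ℓ} → ExcludedMiddle ℓ) where

  <ω^-⊕ : (κ : Ord ℓ) → ⊕-Closed (ω^ κ) → ∀ k l {α β : Ord ℓ} →
          α < ω^ κ · fromℕ k → β < ω^ κ · fromℕ l → α ⊕ β < ω^ κ · fromℕ (suc (k ℕ.+ l))
  <ω^-⊕ κ closed k l {α} {β} p q =
    ⊕-mono-≤ (extend k α p) (extend l β q)
      ⟨≤≤⟩ ⊕-·-≤ (ω^ κ) (ω^>𝟎 κ) closed k l 𝟎 𝟎 (ω^>𝟎 κ) (ω^>𝟎 κ)
      ⟨≤<⟩ +-monoʳ-< (ω^ κ · fromℕ (k ℕ.+ l)) (closed (ω^>𝟎 κ) (ω^>𝟎 κ))
      ⟨<≤⟩ ·-osuc-≥ (ω^ κ) (fromℕ (k ℕ.+ l))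
    where
    extend : ∀ m γ → γ < ω^ κ · fromℕ m → γ ≤ ω^ κ · fromℕ m + 𝟎
    extend m γ r = <⇒≤ γ (ω^ κ · fromℕ m) r ⟨≤≤⟩ α≤α+β (ω^ κ · fromℕ m) 𝟎

  -- Nonzero `α` and `β` lie below finite multiples of smaller powers. Over the larger of the two
  -- exponents, closed by induction, the multiples add up to a finite multiple, still below `ω^ ε`.
  ω^-⊕-closed : (ε : Ord ℓ) → ⊕-Closed (ω^ ε)
  ω^-⊕-closed ε@(lsup I f) {α} {β} p q with <-ω^ {γ = α} ε p | <-ω^ {γ = β} ε q
  ... | inj₁ α≤𝟎 | _        = ⊕-identityˡ-≤ α≤𝟎 ⟨≤<⟩ q
  ... | inj₂ _   | inj₁ β≤𝟎 = ⊕-identityʳ-≤ β≤𝟎 ⟨≤<⟩ p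
  ... | inj₂ (i , k , r) | inj₂ (j , l , s) with ≤-or-> lem (f i) (f j)
  ...   | inj₁ i≤j = <ω^-⊕ (f j) (ω^-⊕-closed (f j)) k l
                       (r ⟨<≤⟩ ·-monoˡ-≤ (fromℕ k) (ω^-mono-≤ i≤j)) s
                     ⟨<≤⟩ <⇒≤ (ω^ (f j) · fromℕ (suc (k ℕ.+ l))) (ω^ ε)
                            (ω^·-< {β = ε} (branch-< ε j) (suc (k ℕ.+ l)))
  ...   | inj₂ j<i = <ω^-⊕ (f i) (ω^-⊕-closed (f i)) k l
                       r (s ⟨<≤⟩ ·-monoˡ-≤ (fromℕ l) (ω^-mono-≤ (<⇒≤ (f j) (f i) j<i)))
                     ⟨<≤⟩ <⇒≤ (ω^ (f i) · fromℕ (suc (k ℕ.+ l))) (ω^ ε)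
                            (ω^·-< {β = ε} (branch-< ε i) (suc (k ℕ.+ l)))

  -- A value below the left side is below `α` or at most `α + β` with `β < ω^ ε`, and `α + β` is
  -- dominated by the natural sum.
  ω^-absorb : (ε : Ord ℓ) {α : Ord ℓ} → α < ω^ ε → α + ω^ ε ≤ ω^ ε
  ω^-absorb ε {α} p = ≤-intro (α + ω^ ε) (ω^ ε) λ b →
    [ (λ q → <-trans q p)
    , (λ (j , q) → q ⟨≤≤⟩ +≤⊕ α (branch (ω^ ε) j)
                     ⟨≤<⟩ ω^-⊕-closed ε p (branch-< (ω^ ε) j)) ]′
    (<-+ α (ω^ ε) (branch-< (α + ω^ ε) b))

  ω^-osuc : {ε : Ord ℓ} → 𝟎 {ℓ} < ε → {α : Ord ℓ} → α < ω^ ε → osuc α < ω^ ε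
  ω^-osuc {ε = ε} ε>𝟎 {α} p =
    <⇒osuc≤ {α = α} {α ⊕ 𝟏} (α≤α⊕β α 𝟎 ⟨≤<⟩ ⊕-monoʳ-< α (tt , ≤-refl 𝟎))
    ⟨≤<⟩ ω^-⊕-closed ε p (𝟏≤ω^ 𝟎 ⟨≤<⟩ ω^-mono-< {β = ε} ε>𝟎)

  -- 1 + (ρ - 1) = ρ turns n < ρ into n + 1 < ρ.
  ≤-𝟏⇒ω≤ : (ρ : Ord ℓ) → 𝟎 {ℓ} < ρ → ρ ≤ ρ - 𝟏 → ω {ℓ} ≤ ρ
  ≤-𝟏⇒ω≤ ρ@(lsup K h) ρ>𝟎 ρ≤ρ-𝟏 (lift n) = finite n
    where
    osuc≤𝟏+ : ∀ n → osuc (fromℕ n) ≤ 𝟏 + fromℕ n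
    osuc≤𝟏+ zero    _ = inj₁ tt , 𝟎≤ 𝟎
    osuc≤𝟏+ (suc n) _ = inj₂ tt , osuc≤𝟏+ n

    finite : ∀ n → fromℕ n < ρ
    finite zero    = ρ>𝟎
    finite (suc n) =
      let (k , 𝟏≤hk) , p = finite n ⟨<≤⟩ ρ≤ρ-𝟏
      in k , (osuc≤𝟏+ n ⟨≤≤⟩ +-monoʳ-≤ 𝟏 p ⟨≤≤⟩ proj₁ (+-difference lem 𝟏 (h k) 𝟏≤hk))

-- Widths of subsets

module Game (P : Preorder c e r) where
  open Preorder P using (Carrier)

  infix 9 _⊥_

  _⊥_ : Pred Carrier r → Carrier → Pred Carrier r
  (S ⊥ x) y = S y × Incomparable P x y

  -- Bounds for the width of S by β, read off the recursive description
  -- w(S) = sup { w(S ⊥ x) + 1 ∣ x ∈ S }.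

  Width≤ : Pred Carrier r → Ord a → Set (c ⊔ r ⊔ a)
  Width≤ S (lsup J g) = ∀ x → S x → ∃[ j ] Width≤ (S ⊥ x) (g j)

  Width≥ : Pred Carrier r → Ord a → Set (c ⊔ r ⊔ a)
  Width≥ S (lsup J g) = ∀ j → ∃[ x ] S x × Width≥ (S ⊥ x) (g j)

  Width≤-resp : {S T : Pred Carrier r} (β : Ord a) (γ : Ord b) →
                T ⊆ S → β ≤ γ → Width≤ S β → Width≤ T γ
  Width≤-resp (lsup I f) (lsup J g) T⊆S p w x Tx =
    let i , v = w x (T⊆S Tx)
        j , q = p i
    in j , Width≤-resp (f i) (g j) (λ (Ty , x⊥y) → T⊆S Ty , x⊥y) q v

  Width≥-resp : {S T : Pred Carrier r} (β : Ord a) (γ : Ord b) →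
                S ⊆ T → γ ≤ β → Width≥ S β → Width≥ T γ
  Width≥-resp (lsup I f) (lsup J g) S⊆T p w j =
    let i , q       = p j
        x , Sx , v = w i
    in x , S⊆T Sx , Width≥-resp (f i) (g j) (λ (Sy , x⊥y) → S⊆T Sy , x⊥y) q v

  -- Each chosen point lies in `S` or in `T` and lowers the bound on that side; the natural sum
  -- allows for every interleaving of the two descents.
  Width≤-∪ : {S T U : Pred Carrier r} (β γ : Ord ℓ) → (∀ {x} → U x → S x ⊎ T x) →
             Width≤ S β → Width≤ T γ → Width≤ U (β ⊕ γ)
  Width≤-∪ β@(lsup I f) γ@(lsup J g) cover w v x Ux =
    [ (λ Sx → let i , w′ = w x Sx in inj₁ i ,
         Width≤-∪ (f i) γ
           (λ (Uy , x⊥y) → [ (λ Sy → inj₁ (Sy , x⊥y)) , inj₂ ]′ (cover Uy)) w′ v)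
    , (λ Tx → let j , v′ = v x Tx in inj₂ j ,
         Width≤-∪ β (g j)
           (λ (Uy , x⊥y) → [ inj₁ , (λ Ty → inj₂ (Ty , x⊥y)) ]′ (cover Uy)) w v′)
    ]′ (cover Ux)

  -- An antichain is built first inside S, while a set T t of width at least γ
  -- that is incomparable to everything chosen so far is kept in reserve.
  Width≥-+ : {I : Set p} (T : I → Pred Carrier r) (γ β : Ord ℓ) →
             (∀ t → Width≥ (T t) γ) →
             {S U : Pred Carrier r} →
             (∀ t {x} → S x → ∃[ t′ ] T t′ ⊆ T t × (∀ {y} → T t′ y → Incomparable P x y)) →
             ∀ t → S ⊆ U → T t ⊆ U → Width≥ S β → Width≥ U (γ + β)
  -- An index of `γ` means that the antichain leaves `S` and continues in the reserve.
  Width≥-+ T γ@(lsup K h) (lsup J g) wT reserve t S⊆U T⊆U wS (inj₁ k) =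
    Width≥-resp γ γ T⊆U (≤-refl γ) (wT t) k
  Width≥-+ T γ@(lsup K h) (lsup J g) wT reserve t S⊆U T⊆U wS (inj₂ j) =
    let x , Sx , w        = wS j
        t′ , T′⊆T , T′⊥x = reserve t Sx
    in x , S⊆U Sx ,
       Width≥-+ T γ (g j) wT (λ t (Sy , _) → reserve t Sy) t′
         (λ (Sy , x⊥y) → S⊆U Sy , x⊥y) (λ Ty → T⊆U (T′⊆T Ty) , T′⊥x Ty) w

  Width≥-ω^ : {S : Pred Carrier r} (ε : Ord ℓ) → ∃ S →
              (∀ i k → Width≥ S (ω^ (branch ε i) · fromℕ k)) → Width≥ S (ω^ ε)
  -- This branch is the term `𝟏` in the definition of `ω^_`, for which a single point suffices.
  Width≥-ω^ (lsup I f) (x , Sx) w (nothing , _)         = x , Sx , λ ()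
  Width≥-ω^ (lsup I f) _ w (just i , lift k , b) =
    Width≥-branch (ω^ (f i) · fromℕ k + ω^ (f i)) b
      (Width≥-resp (ω^ (f i) · fromℕ (suc k)) (ω^ (f i) · fromℕ k + ω^ (f i))
        (λ Sy → Sy) (·-osuc-≥ (ω^ (f i)) (fromℕ k)) (w i (suc k)))
    where
    Width≥-branch : {S : Pred Carrier r} (β : Ord ℓ) (b : Branch β) → Width≥ S β →
                    ∃[ x ] S x × Width≥ (S ⊥ x) (branch β b)
    Width≥-branch (lsup J g) j w = w j

  -- Keeping the witness `β` lets finite unions be bounded by natural sums of the witnesses, which
  -- stay below a closed `κ`.
  Width< : Pred Carrier r → Ord a → Set _
  Width< {a} S κ = Σ[ β ∈ Ord a ] β < κ × Width≤ S β

  Width<-⊆ : {S T : Pred Carrier r} {κ : Ord ℓ} → T ⊆ S → Width< S κ → Width< T κ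
  Width<-⊆ T⊆S (β , β<κ , w) = β , β<κ , Width≤-resp β β T⊆S (≤-refl β) w

  Width<-∅ : {S : Pred Carrier r} {κ : Ord ℓ} → 𝟎 {ℓ} < κ → (∀ x → ¬ S x) → Width< S κ
  Width<-∅ κ>𝟎 empty = 𝟎 , κ>𝟎 , λ x Sx → contradiction Sx (empty x)

  Width<-∪ : {S T U : Pred Carrier r} {κ : Ord ℓ} → ⊕-Closed κ → (∀ {x} → U x → S x ⊎ T x) →
             Width< S κ → Width< T κ → Width< U κ
  Width<-∪ closed cover (β , β<κ , w) (γ , γ<κ , v) =
    β ⊕ γ , closed β<κ γ<κ , Width≤-∪ β γ cover w v

  Width<-⋃ : {S : Fin n → Pred Carrier r} {U : Pred Carrier r} {κ : Ord ℓ} →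
             𝟎 {ℓ} < κ → ⊕-Closed κ → (∀ {x} → U x → ∃[ i ] S i x) →
             (∀ i → Width< (S i) κ) → Width< U κ
  Width<-⋃ {n = zero}  κ>𝟎 closed cover w =
    Width<-∅ κ>𝟎 λ x Ux → contradiction (proj₁ (cover Ux)) λ ()
  Width<-⋃ {n = suc n} {S = S} {U} κ>𝟎 closed cover w =
    Width<-∪ closed split (w zero)
      (Width<-⋃ {S = S ∘ suc} {U = λ x → ∃[ i ] S (suc i) x} κ>𝟎 closed (λ x∈ → x∈) (w ∘ suc))
    where
    split : ∀ {x} → U x → S zero x ⊎ ∃[ i ] S (suc i) x
    split Ux with cover Ux
    ... | zero  , Sx = inj₁ Sx
    ... | suc i , Sx = inj₂ (i , Sx)

  Width<⇒Width≤ : {S : Pred Carrier r} (κ : Ord ℓ) →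
                  (∀ x → S x → Width< (S ⊥ x) κ) → Width≤ S κ
  Width<⇒Width≤ κ@(lsup J g) w x Sx =
    let β , (j , β≤gj) , v = w x Sx
    in j , Width≤-resp β (g j) (λ Sy → Sy) β≤gj v

-- Boxes of ordinals

module Boxes (lem : ∀ {ℓ} → ExcludedMiddle ℓ) {ℓ : Level} {n : ℕ} where
  open Classical lem

  -- One ambient order for all boxes, so that shifted and shortened boxes are merely subsets of it.
  Ordⁿ : Preorder _ ℓ ℓ
  Ordⁿ = ∏ {n = n} (λ _ → ≤-preorder ℓ)

  open Game Ordⁿ public

  In : Ord ℓ → Ord ℓ → Pred (Ord ℓ) ℓ
  In b l y = b ≤ y × y < b + l

  Box : Vector (Ord ℓ) n → Vector (Ord ℓ) n → Pred (Vector (Ord ℓ) n) ℓ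
  Box b l y = ∀ i → In (b i) (l i) (y i)

  ≰⇒∃< : {x y : Vector (Ord ℓ) n} → ¬ (∀ i → x i ≤ y i) → ∃[ i ] y i < x i
  ≰⇒∃< {x} {y} x≰y =
    let i , xi≰yi = ¬∀⟶∃¬ n (λ i → x i ≤ y i) (λ _ → lem) x≰y
    in i , [ (λ xi≤yi → contradiction xi≤yi xi≰yi) , (λ p → p) ]′ (≤-or-> lem (x i) (y i))

  In⇒≤ : {b l y : Ord ℓ} → In b l y → 𝟎 {ℓ} < l → ∃[ j ] y ≤ b + branch l j
  In⇒≤ {b} {l} {y} (b≤y , y<b+l) l>𝟎 with <-+ {γ = y} b l y<b+l
  ... | inj₁ y<b = contradiction (b≤y ⟨≤<⟩ y<b) (<-irrefl b)
  ... | inj₂ p   = p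

  -- An interval of length `ω^ 𝟎`, that is 1, contains only `b` up to `_≈_`.
  In-ω^𝟎 : {b α x y : Ord ℓ} → α ≤ 𝟎 {ℓ} → In b (ω^ α) x → In b (ω^ α) y → y ≤ x
  In-ω^𝟎 {b} {α} {x} {y} α≤𝟎 p q with In⇒≤ q (ω^>𝟎 α)
  ... | j , y≤b+ with <-ω^ α (branch-< (ω^ α) j)
  ...   | inj₁ r           = y≤b+ ⟨≤≤⟩ +-monoʳ-≤ b r ⟨≤≤⟩ +-identityʳ-≤ b ⟨≤≤⟩ proj₁ p
  ...   | inj₂ (i , _ , _) = ≮𝟎 {α = branch α i} (branch-< α i ⟨<≤⟩ α≤𝟎)

  base∈Box : (b l : Vector (Ord ℓ) n) → (∀ i → 𝟎 {ℓ} < l i) → Box b l b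
  base∈Box b l l>𝟎 i =
    ≤-refl (b i) , (α≤α+β (b i) 𝟎 ⟨≤<⟩ +-monoʳ-< (b i) (l>𝟎 i))

  Box-at : {b l y : Vector (Ord ℓ) n} {i : Fin n} {x : Ord ℓ} →
           Box b (l [ i ]≔ x) y → In (b i) x (y i)
  Box-at {b} {l} {y} {i} y∈ = ≔-at (λ z → In (b i) z (y i)) l i (y∈ i)

  Box-off : {b l y : Vector (Ord ℓ) n} {i j : Fin n} {x : Ord ℓ} → j ≢ i →
            Box b (l [ i ]≔ x) y → In (b j) (l j) (y j)
  Box-off {b} {l} {y} {i} {j} j≢i y∈ = ≔-off (λ z → In (b j) z (y j)) l i j≢i (y∈ j)

  Box-≔ : {b l y : Vector (Ord ℓ) n} {i : Fin n} {x : Ord ℓ} →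
          In (b i) x (y i) → (∀ j → j ≢ i → In (b j) (l j) (y j)) → Box b (l [ i ]≔ x) y
  Box-≔ {b} {y = y} = ≔-elim (λ j z → In (b j) z (y j))

  In-upper : {b x y : Ord ℓ} → In b x y → {z : Ord ℓ} → x ≤ z → In b z y
  In-upper {b} (b≤y , y<b+x) x≤z = b≤y , (y<b+x ⟨<≤⟩ +-monoʳ-≤ b x≤z)

  -- Stacking k boxes in direction i.  The antichain is built from the top box
  -- downwards; each new element x is answered by moving the boxes underneath
  -- beyond x in a direction j whose length absorbs the shift.
  Width≥-stack : {i j : Fin n} → j ≢ i → (l : Vector (Ord ℓ) n) (c γ : Ord ℓ) → 𝟎 {ℓ} < l j →
                 (∀ {s} → s < l j → osuc s < l j) → (∀ {s} → s < l j → s + l j ≤ l j) →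
                 (∀ b → Width≥ (Box b (l [ i ]≔ c)) γ) →
                 ∀ k b → Width≥ (Box b (l [ i ]≔ (c · fromℕ k))) (γ · fromℕ k)
  Width≥-stack j≢i l c γ lj>𝟎 lj-osuc lj-absorb w zero b (() , _)
  Width≥-stack {i} {j} j≢i l c γ lj>𝟎 lj-osuc lj-absorb w (suc k) b =
    Width≥-resp (γ · fromℕ k + γ) (γ · fromℕ (suc k)) (λ Ux → Ux) (·-osuc-≤ γ (fromℕ k))
      (Width≥-+ T (γ · fromℕ k) γ wT reserve (𝟎 , lj>𝟎) S⊆U
        (λ (y∈ , _) → Box-≔ {b} {l} (In-upper (Box-at {b} {l} y∈) ck≤csk)
                            (λ _ m≢i → Box-off {b} {l} m≢i y∈))
        (w (b [ i ]≔ (b i + c · fromℕ k))))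
    where
    S U : Pred (Vector (Ord ℓ) n) ℓ
    S = Box (b [ i ]≔ (b i + c · fromℕ k)) (l [ i ]≔ c)
    U = Box b (l [ i ]≔ (c · fromℕ (suc k)))

    -- The reserve is the stack of the lower `k` boxes, cut down to the points at offset at least
    -- `s` in direction `j`.
    T : ∃[ s ] s < l j → Pred (Vector (Ord ℓ) n) ℓ
    T (s , _) y = Box b (l [ i ]≔ (c · fromℕ k)) y × b j + s ≤ y j

    ck≤csk : c · fromℕ k ≤ c · fromℕ (suc k)
    ck≤csk = α≤α+β (c · fromℕ k) c ⟨≤≤⟩ ·-osuc-≥ c (fromℕ k)

    S-at : ∀ {y} → S y → In (b i + c · fromℕ k) c (y i)
    S-at {y} y∈ = ≔-at (λ z → In z c (y i)) b i (Box-at {b [ i ]≔ _} {l} y∈)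

    S-off : ∀ {y m} → m ≢ i → S y → In (b m) (l m) (y m)
    S-off {y} {m} m≢i y∈ =
      ≔-off (λ z → In z (l m) (y m)) b i m≢i (Box-off {b [ i ]≔ _} {l} m≢i y∈)

    S⊆U : S ⊆ U
    S⊆U {y} y∈ = Box-≔ {b} {l}
      ( (α≤α+β (b i) (c · fromℕ k) ⟨≤≤⟩ proj₁ (S-at y∈))
      , (proj₂ (S-at y∈) ⟨<≤⟩ +-assoc-≤ (b i) (c · fromℕ k) c
           ⟨<≤⟩ +-monoʳ-≤ (b i) (·-osuc-≥ c (fromℕ k))) )
      (λ _ m≢i → S-off m≢i y∈)

    wT : ∀ t → Width≥ (T t) (γ · fromℕ k)
    wT (s , s<lj) =
      Width≥-resp (γ · fromℕ k) (γ · fromℕ k) shifted⊆T (≤-refl (γ · fromℕ k))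
        (Width≥-stack j≢i l c γ lj>𝟎 lj-osuc lj-absorb w k (b [ j ]≔ (b j + s)))
      where
      shifted⊆T : Box (b [ j ]≔ (b j + s)) (l [ i ]≔ (c · fromℕ k)) ⊆ T (s , s<lj)
      shifted⊆T {y} y∈ =
        Box-≔ {b} {l}
          (≔-off (λ z → In z (c · fromℕ k) (y i)) b j (λ i≡j → j≢i (sym i≡j))
            (Box-at {b [ j ]≔ _} {l} y∈))
          rest ,
        proj₁ at-j
        where
        at-j : In (b j + s) (l j) (y j)
        at-j = ≔-at (λ z → In z (l j) (y j)) b j (Box-off {b [ j ]≔ _} {l} j≢i y∈)

        rest : ∀ m → m ≢ i → In (b m) (l m) (y m)
        rest m m≢i with m ≟ j
        ... | yes refl = (α≤α+β (b j) s ⟨≤≤⟩ proj₁ at-j) ,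
                         (proj₂ at-j ⟨<≤⟩ +-assoc-≤ (b j) s (l j)
                            ⟨<≤⟩ +-monoʳ-≤ (b j) (lj-absorb s<lj))
        ... | no m≢j   = ≔-off (λ z → In z (l m) (y m)) b j m≢j
                           (Box-off {b [ j ]≔ _} {l} m≢i y∈)

    max : ∀ {s s′} → s < l j → s′ < l j → ∃[ t ] t < l j × s ≤ t × s′ ≤ t
    max {s} {s′} p q with ≤-or-> lem s s′
    ... | inj₁ s≤s′ = s′ , q , s≤s′ , ≤-refl s′
    ... | inj₂ s′<s = s , p , ≤-refl s , <⇒≤ s′ s s′<s

    reserve : ∀ t {x} → S x →
              ∃[ t′ ] T t′ ⊆ T t × (∀ {y} → T t′ y → Incomparable Ordⁿ x y)
    reserve (s , s<lj) {x} x∈ =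
      let m , xj≤    = In⇒≤ (S-off j≢i x∈) lj>𝟎
          r          = branch (l j) m
          -- The new shift `t` is at least the old one and lies beyond the offset `r` of `x` in
          -- direction `j`.
          t , t<lj , s≤t , r+1≤t = max s<lj (lj-osuc (branch-< (l j) m))
      in (t , t<lj) ,
         (λ (y∈ , bj+t≤yj) → y∈ , (+-monoʳ-≤ (b j) s≤t ⟨≤≤⟩ bj+t≤yj)) ,
         λ {y} (y∈ , bj+t≤yj) →
           -- In direction `i`, `y` lies strictly below `x`, which is in the top box; in direction
           -- `j` the shift puts `y` strictly above `x`.
           (λ x≤y → contradiction
              (proj₂ (Box-at {b} {l} y∈) ⟨<≤⟩ proj₁ (S-at x∈) ⟨<≤⟩ x≤y i) (<-irrefl (y i))) ,
           (λ y≤x → contradiction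
              (xj≤ ⟨≤<⟩ +-monoʳ-< (b j) (osuc≤⇒< r+1≤t) ⟨<≤⟩ bj+t≤yj ⟨<≤⟩ y≤x j)
              (<-irrefl (x j)))

  -- Cutting side `i` into `k` intervals of length `c` gives a finite union, and `κ` is closed under
  -- natural sums.
  Width<-stack : {i : Fin n} (l : Vector (Ord ℓ) n) (c : Ord ℓ) {κ : Ord ℓ} →
                 𝟎 {ℓ} < κ → ⊕-Closed κ → (∀ b → Width< (Box b (l [ i ]≔ c)) κ) →
                 ∀ k b → Width< (Box b (l [ i ]≔ (c · fromℕ k))) κ
  Width<-stack {i} l c κ>𝟎 closed w zero b = Width<-∅ κ>𝟎 λ y y∈ →
    let bi≤yi , yi< = Box-at {b} {l} y∈ in contradiction
      (bi≤yi ⟨≤<⟩ yi< ⟨<≤⟩ +-monoʳ-≤ (b i) (·-zero c) ⟨<≤⟩ +-identityʳ-≤ (b i)) (<-irrefl (b i))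
  Width<-stack {i} l c κ>𝟎 closed w (suc k) b =
    Width<-∪ closed split (Width<-stack l c κ>𝟎 closed w k b) (w (b [ i ]≔ (b i + c · fromℕ k)))
    where
    split : ∀ {y} → Box b (l [ i ]≔ (c · fromℕ (suc k))) y →
            Box b (l [ i ]≔ (c · fromℕ k)) y ⊎
            Box (b [ i ]≔ (b i + c · fromℕ k)) (l [ i ]≔ c) y
    split {y} y∈ with ≤-or-> lem (b i + c · fromℕ k) (y i)
    ... | inj₂ yi< = inj₁ (Box-≔ {b} {l} (proj₁ (Box-at {b} {l} y∈) , yi<)
                                (λ _ m≢i → Box-off {b} {l} m≢i y∈))
    ... | inj₁ ≤yi = inj₂ (Box-≔ {b [ i ]≔ _} {l}
      (subst (λ z → In z c (y i)) (sym (updateAt-updates i b))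
        (≤yi , (proj₂ (Box-at {b} {l} y∈) ⟨<≤⟩ +-monoʳ-≤ (b i) (·-osuc-≤ c (fromℕ k))
                 ⟨<≤⟩ +-assoc-≥ (b i) (c · fromℕ k) c)))
      λ m m≢i → subst (λ z → In z (l m) (y m)) (sym (updateAt-minimal m i b m≢i))
                  (Box-off {b} {l} m≢i y∈))

-- The width as the rank of the forest of antichains

AllPairs-++⁻ : {A : Set a} {R : Rel A q} (xs : List A) {y : A} {ys : List A} →
               AllPairs R (xs ++ y ∷ ys) → All (λ x → R x y) xs
AllPairs-++⁻ []       _          = []
AllPairs-++⁻ (x ∷ xs) (Rx ∷ Rxs) = All.head (++⁻ʳ xs Rx) ∷ AllPairs-++⁻ xs Rxs

module Rank (X : Preorder b p r) (P : Preorder c e r) (f : Preorder.Carrier X → Preorder.Carrier P)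
            (f-reflects  : ∀ {x y} → Incomparable P (f x) (f y) → Incomparable X x y)
            (f-preserves : ∀ {x y} → Incomparable X x y → Incomparable P (f x) (f y)) where
  open Game P
  private module X = Preorder X

  _⟂_ : List X.Carrier → X.Carrier → Set _
  xs ⟂ y = All (λ x → Incomparable X x y) xs

  -- `S` contains the images of all points that can still extend `s`. An extension may append
  -- several points at once; only the first, `z`, is charged to the bound, and later extensions stay
  -- in `S ⊥ f z`.
  rankOf-≤ : {s : AntichainSequence X} (s-acc : Acc (_⊐_ X) s) {S : Pred _ r} (β : Ord ℓ) →
             (∀ {y} → proj₁ s ⟂ y → S (f y)) → Width≤ S β → rankOf s-acc ≤ β
  rankOf-≤ {s = xs , _} (acc rs) (lsup J g) residual w ((_ , ≢[] , pairs) , z , zs , refl) =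
    let j , w′ = w (f z) (residual (AllPairs-++⁻ xs pairs))
    in j , rankOf-≤ (rs (z , zs , refl)) (g j)
             (λ ys⟂y → residual (++⁻ˡ xs ys⟂y) , f-preserves (All.head (++⁻ʳ xs ys⟂y))) w′

  rank-≤ : (wf : WellFounded (_⊐_ X)) {S : Pred _ r} (β : Ord ℓ) →
           (∀ y → S (f y)) → Width≤ S β → rank wf ≤ β
  rank-≤ wf β total w (lift ([] , ≢[] , _)) = contradiction refl ≢[]
  rank-≤ wf (lsup J g) total w (lift s@(z ∷ zs , _)) =
    let j , w′ = w (f z) (total z)
    in j , rankOf-≤ (wf s) (g j) (λ s⟂y → total _ , f-preserves (All.head s⟂y)) w′

  -- Dually, every point of `S` comes from one that can extend `s`, so each choice in `Width≥`
  -- appends one element.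
  rankOf-≥ : {s : AntichainSequence X} (s-acc : Acc (_⊐_ X) s) {S : Pred _ r} (β : Ord ℓ) →
             (∀ {q} → S q → ∃[ y ] f y ≡ q × proj₁ s ⟂ y) → Width≥ S β → β ≤ rankOf s-acc
  rankOf-≥ {s = xs , _ , pairs} (acc rs) {S} (lsup J g) residual w j with w j
  ... | q , Sq , w′ with residual Sq
  ...   | y , refl , xs⟂y =
    ((xs ++ y ∷ [] , (λ ≡[] → contradiction (++-conicalʳ xs (y ∷ []) ≡[]) λ ())
                   , AllPairs.++⁺ pairs ([] ∷ []) (All.map (_∷ []) xs⟂y))
    , y , [] , refl) ,
    rankOf-≥ (rs (y , [] , refl)) (g j) residual′ w′
    where
    residual′ : ∀ {q} → (S ⊥ f y) q → ∃[ z ] f z ≡ q × (xs ++ y ∷ []) ⟂ z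
    residual′ (Sq , y⊥q) with residual Sq
    ... | z , refl , xs⟂z = z , refl , ∷ʳ⁺ xs⟂z (f-reflects y⊥q)

  rank-≥ : (wf : WellFounded (_⊐_ X)) {S : Pred _ r} (β : Ord ℓ) →
           (∀ {q} → S q → ∃[ y ] f y ≡ q) → Width≥ S β → β ≤ rank wf
  rank-≥ wf {S} (lsup J g) onto w j with w j
  ... | q , Sq , w′ with onto Sq
  ...   | y , refl =
    let s = y ∷ [] , (λ ()) , [] ∷ []
    in lift s , rankOf-≥ (wf s) (g j) residual w′
    where
    residual : ∀ {q} → (S ⊥ f y) q → ∃[ z ] f z ≡ q × (y ∷ []) ⟂ z
    residual (Sq , y⊥q) with onto Sq
    ... | z , refl = z , refl , f-reflects y⊥q ∷ []

-- Boxes with sides ω^αᵢ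

module ProductWidth (lem : ∀ {ℓ} → ExcludedMiddle ℓ) {ℓ : Level} {m : ℕ} where
  open Classical lem
  open Boxes lem {ℓ} {suc m}

  Index : Set
  Index = Fin (suc m)

  Exponents : Set _
  Exponents = Vector (Ord ℓ) (suc m)

  ω^Box : Exponents → Exponents → Pred Exponents ℓ
  ω^Box b α = Box b (λ i → ω^ (α i))

  -- Updating an exponent and updating the corresponding side agree only pointwise; this inclusion
  -- and the next pass between the two forms.
  ω^Box-⊆ : {b α : Exponents} {i : Index} {α′ : Ord ℓ} →
            Box b ((λ j → ω^ (α j)) [ i ]≔ (ω^ α′)) ⊆ ω^Box b (α [ i ]≔ α′)
  ω^Box-⊆ {b} {α} {i} {α′} {y} y∈ = ≔-elim (λ j z → In (b j) (ω^ z) (y j)) {α} {i}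
    (Box-at {b} {λ j → ω^ (α j)} y∈) (λ _ j≢i → Box-off {b} {λ j → ω^ (α j)} j≢i y∈)

  ω^Box-⊇ : {b α : Exponents} {i : Index} {α′ : Ord ℓ} →
            ω^Box b (α [ i ]≔ α′) ⊆ Box b ((λ j → ω^ (α j)) [ i ]≔ (ω^ α′))
  ω^Box-⊇ {b} {α} {i} {α′} {y} y∈ = Box-≔ {b} {λ j → ω^ (α j)}
    (≔-at (λ z → In (b i) (ω^ z) (y i)) α i (y∈ i))
    (λ j j≢i → ≔-off (λ z → In (b j) (ω^ z) (y j)) α i j≢i (y∈ j))

  base∈ω^Box : (b α : Exponents) → ω^Box b α b
  base∈ω^Box b α = base∈Box b (λ i → ω^ (α i)) (λ i → ω^>𝟎 (α i))

  -- Sides other than `i₀` have length 1, so two points can differ only in coordinate `i₀`, where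
  -- they are comparable.
  Width≤-chain : (b α : Exponents) (i₀ : Index) → (∀ i → i ≢ i₀ → α i ≤ 𝟎 {ℓ}) →
                 Width≤ (ω^Box b α) (𝟏 {a})
  Width≤-chain b α i₀ small x x∈ = tt , λ y (y∈ , x≰y , y≰x) →
    let i , yi<xi = ≰⇒∃< x≰y
        j , xj<yj = ≰⇒∃< y≰x
        i≡i₀ = at-i₀ x∈ y∈ yi<xi
        j≡i₀ = at-i₀ y∈ x∈ xj<yj
        p = subst (λ i → y i < x i) i≡i₀ yi<xi
        q = subst (λ j → x j < y j) j≡i₀ xj<yj
    in contradiction (<-trans {β = x i₀} {y i₀} p q) (<-irrefl (y i₀))
    where
    at-i₀ : ∀ {x y i} → ω^Box b α x → ω^Box b α y → y i < x i → i ≡ i₀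
    at-i₀ {x} {y} {i} x∈ y∈ yi<xi with i ≟ i₀
    ... | yes i≡i₀ = i≡i₀
    ... | no i≢i₀  = contradiction
      (yi<xi ⟨<≤⟩ In-ω^𝟎 (small i i≢i₀) (y∈ i) (x∈ i)) (<-irrefl (y i))

  -- The upper bound

  exponent : Exponents → Ord ℓ
  exponent α = head α ⊕ (⨁ (tail α) - 𝟏)

  -- Induction on the exponent. Lowering a tail entry strictly lowers the tail sum minus 1 as long
  -- as the new tail sum is positive; `slice` treats the remaining case directly.
  Width≤-ω^ : (α b : Exponents) → Acc _<_ (exponent α) → 𝟎 {ℓ} < ⨁ (tail α) →
              Width≤ (ω^Box b α) (ω^ (exponent α))
  Width≤-ω^ α b (acc rs) ρ>𝟎 = Width<⇒Width≤ κ λ x x∈ →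
    Width<-⋃ {S = S x} κ>𝟎 κ-closed
      (λ (y∈ , x⊥y) → let i , yi<xi = ≰⇒∃< (proj₁ x⊥y) in i , (y∈ , x⊥y) , yi<xi)
      (λ i → pieces i x∈)
    where
    κ : Ord ℓ
    κ = ω^ (exponent α)

    κ>𝟎 : 𝟎 {ℓ} < κ
    κ>𝟎 = ω^>𝟎 (exponent α)

    κ-closed : ⊕-Closed κ
    κ-closed = ω^-⊕-closed (exponent α)

    l : Exponents
    l i = ω^ (α i)

    S : Exponents → Index → Pred Exponents ℓ
    S x i y = (ω^Box b α ⊥ x) y × y i < x i

    recurse : ∀ {i α′} → exponent (α [ i ]≔ α′) < exponent α →
              𝟎 {ℓ} < ⨁ (tail (α [ i ]≔ α′)) →
              ∀ b′ → Width< (Box b′ (l [ i ]≔ (ω^ α′))) κ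
    recurse {i} {α′} ε′<ε ρ′>𝟎 b′ =
      ω^ ε′ , ω^-mono-< {β = exponent α} ε′<ε ,
      Width≤-resp (ω^ ε′) (ω^ ε′) (ω^Box-⊆ {b′} {α} {i}) (≤-refl (ω^ ε′))
        (Width≤-ω^ (α [ i ]≔ α′) b′ (rs ε′<ε) ρ′>𝟎)
      where
      ε′ : Ord ℓ
      ε′ = exponent (α [ i ]≔ α′)

    slice : ∀ i {α′ x} → α′ < α i → ω^Box b α x →
            (∀ b′ → Width< (Box b′ (l [ i ]≔ (ω^ α′))) κ) ⊎ (∀ y → ¬ S x i y)
    slice zero     α′<α x∈ = inj₁ (recurse {zero} (⊕-monoˡ-< (⨁ (tail α) - 𝟏) α′<α) ρ>𝟎)
    slice (suc k) {α′} {x} α′<α x∈ with ≤-or-> lem (⨁ (tail α [ k ]≔ α′)) (𝟎 {ℓ})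
    ... | inj₂ ρ′>𝟎 = inj₁ (recurse {suc k}
      (⊕-monoʳ-< (head α) (-‿monoˡ-< (<⇒osuc≤ {α = 𝟎} ρ′>𝟎) (⨁-≔-< (tail α) k α′<α))) ρ′>𝟎)
    ... | inj₁ ρ′≤𝟎 with ≤-or-> lem (head α) (𝟎 {ℓ})
    -- Only the head direction survives in the lowered box, so it is a chain, of width at most 1.
    ...   | inj₂ α₀>𝟎 = inj₁ λ b′ →
      𝟏 , (𝟏≤ω^ 𝟎 ⟨≤<⟩ ω^-mono-< {β = exponent α} (α₀>𝟎 ⟨<≤⟩ α≤α⊕β (head α) (⨁ (tail α) - 𝟏))) ,
      Width≤-resp 𝟏 𝟏 (ω^Box-⊆ {b′} {α} {suc k}) (≤-refl 𝟏)
        (Width≤-chain b′ (α [ suc k ]≔ α′) zero λ where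
          zero    0≢0 → contradiction refl 0≢0
          (suc j) _   → component≤⨁ (tail α [ k ]≔ α′) j ⟨≤≤⟩ ρ′≤𝟎)
    -- The original box is itself a chain along `suc k`, so no point of it is incomparable to `x`.
    ...   | inj₁ α₀≤𝟎 = inj₂ λ y ((y∈ , _ , y≰x) , yi<xi) →
      let j , xj<yj = ≰⇒∃< y≰x in impossible y∈ yi<xi j xj<yj
      where
      impossible : ∀ {y} → ω^Box b α y → y (suc k) < x (suc k) → ∀ j → ¬ x j < y j
      impossible {y} y∈ yi<xi zero xj<yj =
        <-irrefl (x zero) (xj<yj ⟨<≤⟩ In-ω^𝟎 α₀≤𝟎 (x∈ zero) (y∈ zero))
      impossible {y} y∈ yi<xi (suc j) xj<yj with j ≟ k
      ... | yes refl = <-irrefl (x (suc j)) (<-trans {β = y (suc j)} {x (suc j)} xj<yj yi<xi)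
      ... | no j≢k   = <-irrefl (x (suc j)) (xj<yj ⟨<≤⟩
        In-ω^𝟎 (≔-off (_≤ 𝟎 {ℓ}) (tail α) k j≢k
                 (component≤⨁ (tail α [ k ]≔ α′) j ⟨≤≤⟩ ρ′≤𝟎)) (x∈ (suc j)) (y∈ (suc j)))

    pieces : ∀ i {x} → ω^Box b α x → Width< (S x i) κ
    pieces i {x} x∈ with In⇒≤ (x∈ i) (ω^>𝟎 (α i))
    ... | j , xi≤ with <-ω^ (α i) (branch-< (ω^ (α i)) j)
    ...   | inj₁ r≤𝟎 = Width<-∅ κ>𝟎 λ y ((y∈ , _) , yi<xi) → <-irrefl (b i)
      (proj₁ (y∈ i) ⟨≤<⟩ yi<xi ⟨<≤⟩ xi≤ ⟨<≤⟩ +-monoʳ-≤ (b i) r≤𝟎 ⟨<≤⟩ +-identityʳ-≤ (b i))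
    ...   | inj₂ (a , k , r<) with slice i (branch-< (α i) a) x∈
    ...     | inj₂ empty = Width<-∅ κ>𝟎 empty
    ...     | inj₁ w     = Width<-⊆
      (λ ((y∈ , _) , yi<xi) → Box-≔ {b} {l} {i = i}
        (proj₁ (y∈ i) , (yi<xi ⟨<≤⟩ xi≤ ⟨<≤⟩ <⇒≤ _ _ (+-monoʳ-< (b i) r<)))
        (λ j _ → y∈ j))
      (Width<-stack {i} l (ω^ (branch (α i) a)) κ>𝟎 κ-closed w k b)

  -- The lower bound

  Width≥-step : (α : Exponents) {i j : Index} {α′ : Ord ℓ} (γ : Ord ℓ) →
                j ≢ i → 𝟎 {ℓ} < α j → α′ < α i →
                (∀ b → Width≥ (ω^Box b (α [ i ]≔ α′)) γ) →
                ∀ k b → Width≥ (ω^Box b α) (γ · fromℕ k)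
  Width≥-step α {i} {j} {α′} γ j≢i αj>𝟎 α′<αi w k b =
    Width≥-resp (γ · fromℕ k) (γ · fromℕ k) stack⊆ (≤-refl (γ · fromℕ k))
      -- Because `α j` is positive, `ω^ (α j)` is a limit, and it absorbs smaller shifts from the
      -- left.
      (Width≥-stack j≢i l (ω^ α′) γ (ω^>𝟎 (α j)) (ω^-osuc αj>𝟎) (ω^-absorb (α j))
        (λ b → Width≥-resp γ γ (ω^Box-⊇ {b} {α} {i}) (≤-refl γ) (w b)) k b)
    where
    l : Exponents
    l i = ω^ (α i)

    stack⊆ : Box b (l [ i ]≔ (ω^ α′ · fromℕ k)) ⊆ ω^Box b α
    stack⊆ {y} y∈ m with m ≟ i
    ... | yes refl = In-upper (Box-at {b} {l} y∈) (<⇒≤ (ω^ α′ · fromℕ k) (l i) (ω^·-< {β = α i} α′<αi k))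
    ... | no m≢i   = Box-off {b} {l} m≢i y∈

  Width≥-ω^𝟎 : (α b : Exponents) (ε : Ord ℓ) → ε ≤ 𝟎 {ℓ} → Width≥ (ω^Box b α) (ω^ ε)
  Width≥-ω^𝟎 α b ε ε≤𝟎 = Width≥-ω^ ε (b , base∈ω^Box b α)
    λ i → ≮𝟎 {α = branch ε i} (branch-< ε i ⟨<≤⟩ ε≤𝟎)

  ⨁>𝟎⇒∃>𝟎 : {β : Vector (Ord ℓ) n} → 𝟎 {ℓ} < ⨁ β → ∃[ i ] 𝟎 {ℓ} < β i
  ⨁>𝟎⇒∃>𝟎 {β = β} p = let i , β′ , β′<βi , _ = <-⨁ {γ = 𝟎} β p in i , (𝟎≤ β′ ⟨≤<⟩ β′<βi)

  module _ (α : Exponents) (ε : Ord ℓ) where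

    lower-head : {α′ : Ord ℓ} → 𝟎 {ℓ} < ⨁ (tail α) → α′ < head α →
                 (∀ b → Width≥ (ω^Box b (α [ zero ]≔ α′)) (ω^ ε)) →
                 ∀ k b → Width≥ (ω^Box b α) (ω^ ε · fromℕ k)
    lower-head σ>𝟎 α′<α₀ =
      let i , βi>𝟎 = ⨁>𝟎⇒∃>𝟎 σ>𝟎 in Width≥-step α {zero} {suc i} (ω^ ε) (λ ()) βi>𝟎 α′<α₀

    lower-tail : {i : Fin m} {α′ : Ord ℓ} → 𝟎 {ℓ} < head α → α′ < tail α i →
                 (∀ b → Width≥ (ω^Box b (α [ suc i ]≔ α′)) (ω^ ε)) →
                 ∀ k b → Width≥ (ω^Box b α) (ω^ ε · fromℕ k)
    lower-tail {i} α₀>𝟎 α′<αi = Width≥-step α {suc i} {zero} (ω^ ε) (λ ()) α₀>𝟎 α′<αi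

  -- Decreasing one exponent must keep two exponents positive; when the obvious
  -- choice would leave only one, another one achieves the same bound.
  Width≥-ω^-below-sum : (ε : Ord ℓ) (α b : Exponents) → 𝟎 {ℓ} < head α → 𝟎 {ℓ} < ⨁ (tail α) →
                        ε < head α ⊕ ⨁ (tail α) → Width≥ (ω^Box b α) (ω^ ε)
  Width≥-ω^-below-sum ε@(lsup I f) α b α₀>𝟎 σ>𝟎 ε<α₀⊕σ =
    Width≥-ω^ ε (b , base∈ω^Box b α) go
    where
    σ : Ord ℓ
    σ = ⨁ (tail α)

    go-tail : ∀ i {k α′} → α′ < tail α k → f i < head α ⊕ ⨁ (tail α [ k ]≔ α′) →
              ∀ k → Width≥ (ω^Box b α) (ω^ (f i) · fromℕ k)
    go-tail i {k} {α′} α′<αk ε′< l with ≤-or-> lem (⨁ (tail α [ k ]≔ α′)) (𝟎 {ℓ})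
    ... | inj₂ σ′>𝟎 = lower-tail α (f i) α₀>𝟎 α′<αk
      (λ b′ → Width≥-ω^-below-sum (f i) (α [ suc k ]≔ α′) b′ α₀>𝟎 σ′>𝟎 ε′<) l b
    ... | inj₁ σ′≤𝟎 with ≤-or-> lem (f i) (𝟎 {ℓ})
    ...   | inj₁ ε′≤𝟎 = lower-tail α (f i) α₀>𝟎 α′<αk
      (λ b′ → Width≥-ω^𝟎 (α [ suc k ]≔ α′) b′ (f i) ε′≤𝟎) l b
    -- Here `f i < head α`, so the head is lowered to `f i` itself and the untouched positive tail
    -- supplies the strict inequality.
    ...   | inj₂ ε′>𝟎 = lower-head α (f i) σ>𝟎 (ε′< ⟨<≤⟩ ⊕-identityʳ-≤ σ′≤𝟎)
      (λ b′ → Width≥-ω^-below-sum (f i) (α [ zero ]≔ f i) b′ ε′>𝟎 σ>𝟎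
        (α≤α⊕β (f i) 𝟎 ⟨≤<⟩ ⊕-monoʳ-< (f i) σ>𝟎)) l b

    go : ∀ i k → Width≥ (ω^Box b α) (ω^ (f i) · fromℕ k)
    go i k with <-⊕ {γ = ε} (head α) σ ε<α₀⊕σ
    ... | inj₂ (q , ε≤) =
      let k′ , α′ , α′<αk , σq≤ = <-⨁ (tail α) (branch-< σ q)
      in go-tail i α′<αk
           (branch-< ε i ⟨<≤⟩ ε≤ ⟨<≤⟩ ⊕-mono-≤ (≤-refl (head α)) σq≤) k
    ... | inj₁ (p , ε≤) with ≤-or-> lem (branch (head α) p) (𝟎 {ℓ})
    ...   | inj₂ α′>𝟎 = lower-head α (f i) σ>𝟎 (branch-< (head α) p)
      (λ b′ → Width≥-ω^-below-sum (f i) (α [ zero ]≔ branch (head α) p) b′ α′>𝟎 σ>𝟎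
        (branch-< ε i ⟨<≤⟩ ε≤)) k b
    -- The head would vanish, but then `f i < σ`: a tail entry is lowered instead, and the positive
    -- head supplies the strict inequality.
    ...   | inj₁ α′≤𝟎 =
      let k′ , α′ , α′<αk , ε′≤ =
            <-⨁ (tail α) (branch-< ε i ⟨<≤⟩ ε≤ ⟨<≤⟩ ⊕-identityˡ-≤ α′≤𝟎)
      in go-tail i α′<αk
           (ε′≤ ⟨≤≤⟩ β≤α⊕β 𝟎 (⨁ (tail α [ k′ ]≔ α′))
                ⟨≤<⟩ ⊕-monoˡ-< (⨁ (tail α [ k′ ]≔ α′)) α₀>𝟎) k

  ω>𝟎 : {α : Ord ℓ} → ω {ℓ} ≤ α → 𝟎 {ℓ} < α
  ω>𝟎 p = p (lift 0)

  osuc<ω : {α : Ord ℓ} → α < ω {ℓ} → osuc α < ω {ℓ}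
  osuc<ω {α} (lift n , p) = lift (suc n) , osuc-mono {α = α} p

  -- If the lowered summand is still infinite, the induction continues. If it is finite, it can be
  -- replaced by its successor, still below the infinite summand, and the strict inequality for
  -- `Width≥-ω^-below-sum` is gained.
  Width≥-ω^-sum : (ε : Ord ℓ) (α b : Exponents) → ω {ℓ} ≤ head α → ω {ℓ} ≤ ⨁ (tail α) →
                  ε ≤ head α ⊕ ⨁ (tail α) → Width≥ (ω^Box b α) (ω^ ε)
  Width≥-ω^-sum ε@(lsup I f) α b ω≤α₀ ω≤σ ε≤α₀⊕σ =
    Width≥-ω^ ε (b , base∈ω^Box b α) go
    where
    σ : Ord ℓ
    σ = ⨁ (tail α)

    go : ∀ i k → Width≥ (ω^Box b α) (ω^ (f i) · fromℕ k)
    go i k with <-⊕ {γ = f i} (head α) σ (ε≤α₀⊕σ i)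
    ... | inj₁ (p , ε′≤) with ≤-or-> lem (ω {ℓ}) (branch (head α) p)
    ...   | inj₁ ω≤α′ = lower-head α (f i) (ω>𝟎 ω≤σ) (branch-< (head α) p)
      (λ b′ → Width≥-ω^-sum (f i) (α [ zero ]≔ branch (head α) p) b′ ω≤α′ ω≤σ ε′≤) k b
    ...   | inj₂ α′<ω = lower-head α (f i) (ω>𝟎 ω≤σ) (osuc<ω α′<ω ⟨<≤⟩ ω≤α₀)
      (λ b′ → Width≥-ω^-below-sum (f i) (α [ zero ]≔ osuc α′) b′
        (𝟎≤ α′ ⟨≤<⟩ α<osuc α′) (ω>𝟎 ω≤σ)
        (ε′≤ ⟨≤<⟩ ⊕-monoˡ-< σ (α<osuc α′))) k b
      where
      α′ : Ord ℓ
      α′ = branch (head α) p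
    go i k | inj₂ (q , ε′≤) with ≤-or-> lem (ω {ℓ}) (branch σ q)
    ...   | inj₁ ω≤σ′ =
      let k′ , α′ , α′<αk , σ′≤ = <-⨁ (tail α) (branch-< σ q)
      in lower-tail α (f i) (ω>𝟎 ω≤α₀) α′<αk
           (λ b′ → Width≥-ω^-sum (f i) (α [ suc k′ ]≔ α′) b′ ω≤α₀ (ω≤σ′ ⟨≤≤⟩ σ′≤)
             (ε′≤ ⟨≤≤⟩ ⊕-mono-≤ (≤-refl (head α)) σ′≤)) k b
    ...   | inj₂ σ′<ω =
      let σ′ = branch σ q
          -- Descending to a tail sum of at least `osuc σ′` makes it positive and strictly larger
          -- than `σ′`.
          k′ , α′ , α′<αk , σ′+1≤ = <-⨁ {γ = osuc σ′} (tail α) (osuc<ω σ′<ω ⟨<≤⟩ ω≤σ)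
          σ′<σ″ = osuc≤⇒< {α = σ′} σ′+1≤
      in lower-tail α (f i) (ω>𝟎 ω≤α₀) α′<αk
           (λ b′ → Width≥-ω^-below-sum (f i) (α [ suc k′ ]≔ α′) b′ (ω>𝟎 ω≤α₀)
             (𝟎≤ σ′ ⟨≤<⟩ σ′<σ″)
             (ε′≤ ⟨≤<⟩ ⊕-monoʳ-< (head α) σ′<σ″)) k b

  -- If subtracting 1 lowers the tail sum, the exponent is strictly below the full sum. Otherwise
  -- the tail sum is infinite, and so is the head: it bounds every tail entry, and finitely many
  -- finite ordinals have a finite natural sum.
  Width≥-exponent : (α b : Exponents) → (∀ i → α i ≤ head α) → 𝟎 {ℓ} < ⨁ (tail α) →
                    Width≥ (ω^Box b α) (ω^ (exponent α))
  Width≥-exponent α b α≤α₀ ρ>𝟎 with ≤-or-> lem (⨁ (tail α)) (⨁ (tail α) - 𝟏)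
  ... | inj₂ ρ-𝟏<ρ =
    let i , αi>𝟎 = ⨁>𝟎⇒∃>𝟎 ρ>𝟎
    in Width≥-ω^-below-sum (exponent α) α b (αi>𝟎 ⟨<≤⟩ α≤α₀ (suc i)) ρ>𝟎
         (⊕-monoʳ-< (head α) ρ-𝟏<ρ)
  ... | inj₁ ρ≤ρ-𝟏 = Width≥-ω^-sum (exponent α) α b ω≤α₀ ω≤ρ
                       (⊕-mono-≤ (≤-refl (head α)) (γ-β≤γ (⨁ (tail α)) 𝟏))
    where
    ω≤ρ : ω {ℓ} ≤ ⨁ (tail α)
    ω≤ρ = ≤-𝟏⇒ω≤ (⨁ (tail α)) ρ>𝟎 ρ≤ρ-𝟏

    ω≤α₀ : ω {ℓ} ≤ head α
    ω≤α₀ with ≤-or-> lem (ω {ℓ}) (head α)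
    ... | inj₁ p = p
    ... | inj₂ α₀<ω = contradiction
      (ω≤ρ ⟨≤<⟩ <ω⇒⨁<ω (tail α) (λ i → α≤α₀ (suc i) ⟨≤<⟩ α₀<ω)) (<-irrefl ω)

  -- From boxes to the product order

  module _ (α : Exponents) where

    X : WQO _ _ _
    X = productWQO lem (λ i → ω^ (α i))

    open Rank (WQO.preorder X) Ordⁿ (λ x i → proj₁ (x i)) (λ p → p) (λ p → p)

    whole : Pred Exponents ℓ
    whole = ω^Box (λ _ → 𝟎) α

    width-≤ : (β : Ord ℓ) → Width≤ whole β → width lem X ≤ β
    width-≤ β = rank-≤ (⊐-wellFounded lem _ _) β λ x i →
      𝟎≤ (proj₁ (x i)) , (proj₂ (x i) ⟨<≤⟩ β≤α+β 𝟎 (ω^ (α i)))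

    width-≥ : (β : Ord ℓ) → Width≥ whole β → β ≤ width lem X
    width-≥ β = rank-≥ (⊐-wellFounded lem _ _) β λ {x} x∈ →
      (λ i → x i , (proj₂ (x∈ i) ⟨<≤⟩ +≤⊕ 𝟎 (ω^ (α i)) ⟨<≤⟩ ⊕-identityˡ-≤ (𝟎≤ 𝟎))) , refl

mainTheorem9 : (lem : ∀ {ℓ} → ExcludedMiddle ℓ) →
    ∀ {ℓ} (m : ℕ) (α : Vector (Ord ℓ) (suc m)) →
    (∀ {i j} → i Fin.≤ j → α j ≤ α i) →
    ((∀ i → tail α i ≈ 𝟎 {ℓ}) →
    width lem (productWQO lem (λ i → ω^ (α i))) ≈ 𝟏 {ℓ})
    ×
    (¬ (∀ i → tail α i ≈ 𝟎 {ℓ}) →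
    width lem (productWQO lem (λ i → ω^ (α i)))
    ≈ ω^ (head α ⊕ (foldr _⊕_ 𝟎 (tail α) - 𝟏)))
mainTheorem9 lem {ℓ} m α decreasing = trivial , nontrivial
  where
  open ProductWidth lem {ℓ} {m}

  trivial : (∀ i → tail α i ≈ 𝟎 {ℓ}) →
            width lem (productWQO lem (λ i → ω^ (α i))) ≈ 𝟏 {ℓ}
  trivial tail≈𝟎 =
    width-≤ α 𝟏 (Width≤-chain (λ _ → 𝟎) α zero λ where
      zero    0≢0 → contradiction refl 0≢0
      (suc i) _   → proj₁ (tail≈𝟎 i)) ,
    width-≥ α 𝟏 (λ _ → (λ _ → 𝟎) , base∈ω^Box (λ _ → 𝟎) α , λ ())

  nontrivial : ¬ (∀ i → tail α i ≈ 𝟎 {ℓ}) →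
               width lem (productWQO lem (λ i → ω^ (α i))) ≈ ω^ (exponent α)
  nontrivial tail≉𝟎 =
    width-≤ α (ω^ (exponent α)) (Width≤-ω^ α (λ _ → 𝟎) (<-wellFounded (exponent α)) ρ>𝟎) ,
    width-≥ α (ω^ (exponent α)) (Width≥-exponent α (λ _ → 𝟎) (λ _ → decreasing ℕ.z≤n) ρ>𝟎)
    where
    ρ>𝟎 : 𝟎 {ℓ} < ⨁ (tail α)
    ρ>𝟎 with ≤-or-> lem (⨁ (tail α)) (𝟎 {ℓ})
    ... | inj₂ p    = p
    ... | inj₁ ρ≤𝟎 = contradiction
      (λ i → (component≤⨁ (tail α) i ⟨≤≤⟩ ρ≤𝟎) , 𝟎≤ (tail α i)) tail≉𝟎
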